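{- Let $\mathcal I,\mathcal J$ be ideals on $\omega$. If $\mathcal I$ contains a tall summable ideal and Player I has a winning strategy in the game $G(\mathcal J,A,f)$ for all $A\notin\mathcal J$ and all $\mathcal J$-to-one functions $f:A\to\omega$ (in particular, if $\mathcal I$ contains a tall summable ideal and $\mathcal J$ is a Borel ideal such that for each $A\notin\mathcal J$ the ideal $\mathcal J\restriction A$ is not $\le_K$-above any tall summable ideal), then $$\operatorname{cov}(\mathcal M)\le\mathfrak{fip}(\mathcal I,\mathcal J,\omega^\omega).$$
   Context: An ideal on a set $X$ is a family of subsets of $X$ closed under finite unions and subsets, containing all finite subsets of $X$ and not containing $X$; $\mathcal J^+=\mathcal P(X)\setminus\mathcal J$. Borel refers to the topology of $\mathcal P(\omega)\cong\{0,1\}^\omega$. $\operatorname{cov}(\mathcal M)$ is the least number of meager sets covering the real line; $\mathfrak c=2^{\aleph_0}$. A summable ideal is $\mathcal I_g=\{A\subseteq\omega:\sum_{n\in A}g(n)<\infty\}$ with $g:\omega\to[0,\infty)$, $\sum_{n\in\omega}g(n)=\infty$; it is tall (every infinite subset of $\omega$ contains an infinite member) iff $g(n)\to0$. $\mathcal J\restriction A=\{B\cap A:B\in\mathcal J\}$ is an ideal on $A$ for $A\notin\mathcal J$; it is $\le_K$-above $\mathcal I_g$ if there is $f:A\to\omega$ with $f^{ -1}[B]\in\mathcal J\restriction A$ for all $B\in\mathcal I_g$. A function $f:A\to\omega$ is $\mathcal J$-to-one if $f^{ -1}[\{n\}]\in\mathcal J$ for every $n$. The game $G(\mathcal J,A,f)$: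 first Player I plays $k_0\in\omega$; then, for $n=0,1,2,\dots$, Player II plays a finite set $G_n\subseteq\omega$ and Player I responds with $(F_n,k_{n+1})$, where $F_n\subseteq\omega$ is finite, $F_n\cap G_n=\emptyset$, $|F_n|\le k_n$, and $k_{n+1}\in\omega$. Player I wins iff $f^{ -1}[\bigcup_nF_n]\notin\mathcal J\restriction A$; otherwise Player II wins. A nonempty family $\mathcal A\subseteq\mathcal P(\omega)$ has $\mathcal J^+$-FIP if $\bigcap F\in\mathcal J^+$ for each finite $F\subseteq\mathcal A$. $\mathfrak{fip}(\mathcal I,\mathcal J,\mathcal F)$ (for $\mathcal F\subseteq\omega^\omega$) is the minimum of the set consisting of $\mathfrak c^+$ and all cardinals $|\mathcal A|$ such that $\mathcal A\subseteq\mathcal P(\omega)$ has $\mathcal J^+$-FIP and it is not true that for every $f\in\mathcal F$ there is $B\in\mathcal I$ such that $\mathcal A\cup\{f^{ -1}[B]\}$ has $\mathcal J^+$-FIP. -}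

module Defs where

open import Algebra.Bundles using (CommutativeMonoid)
import Algebra.Properties.CommutativeSemigroup as CommutativeSemigroupProperties
open import Level using (Level; 0ℓ; _⊔_) renaming (suc to lsuc)
open import Data.Bool.Base using (Bool)
open import Data.List.Base using (List; []; _∷_; length; foldr; deduplicate; applyUpTo)
open import Data.List.Relation.Unary.All using (All)
open import Data.List.Relation.Unary.Unique.Propositional using (Unique)
import Data.List.Membership.Propositional as List
open import Data.Nat.Base as ℕ using (ℕ; zero; suc)
import Data.Nat.Properties as ℕ
open import Data.Product using (Σ; ∃; _×_; _,_; proj₁; proj₂; Σ-syntax; ∃-syntax)
open import Data.Rational.Base as ℚ using (ℚ; 0ℚ; ½; ∣_∣)
import Data.Rational.Properties as ℚ
open import Data.Sum.Base using (_⊎_)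
open import Function.Bundles using (_↣_; _⇔_)
open import Relation.Binary.Definitions using (_Respects_)
open import Relation.Binary.PropositionalEquality using (_≡_; refl; cong; sym; trans; subst)
open import Relation.Nullary using (¬_)
open import Relation.Unary

-- Real numbers: Cauchy sequences of rationals, with `_≃_` as equality.

record ℝ : Set where
  constructor mkℝ
  field
    seq    : ℕ → ℚ
    cauchy : ∀ ε → 0ℚ ℚ.< ε →
             ∃[ N ] ∀ m n → N ℕ.≤ m → N ℕ.≤ n → ∣ seq m ℚ.- seq n ∣ ℚ.< ε

open ℝ public

infix 4 _≤_ _<_ _≃_

_≤_ : ℝ → ℝ → Set
x ≤ y = ∀ ε → 0ℚ ℚ.< ε → ∃[ N ] ∀ n → N ℕ.≤ n → seq x n ℚ.≤ seq y n ℚ.+ ε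

_<_ : ℝ → ℝ → Set
x < y = ∃[ ε ] 0ℚ ℚ.< ε × (∃[ N ] ∀ n → N ℕ.≤ n → seq x n ℚ.+ ε ℚ.≤ seq y n)

_≃_ : ℝ → ℝ → Set
x ≃ y = x ≤ y × y ≤ x

0ℝ : ℝ
0ℝ = mkℝ (λ _ → 0ℚ) (λ ε 0<ε → 0 , λ _ _ _ _ → 0<ε)

private
  open CommutativeSemigroupProperties
    (CommutativeMonoid.commutativeSemigroup ℚ.+-0-commutativeMonoid) using (interchange)

  half-pos : ∀ ε → 0ℚ ℚ.< ε → 0ℚ ℚ.< ε ℚ.* ½
  half-pos ε 0<ε = subst (ℚ._< ε ℚ.* ½) (ℚ.*-zeroˡ ½) (ℚ.*-monoˡ-<-pos ½ 0<ε)

  half+half : ∀ ε → ε ℚ.* ½ ℚ.+ ε ℚ.* ½ ≡ ε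
  half+half ε = trans (sym (ℚ.*-distribˡ-+ ε ½ ½)) (ℚ.*-identityʳ ε)

  regroup : ∀ a b c d → (a ℚ.+ b) ℚ.- (c ℚ.+ d) ≡ (a ℚ.- c) ℚ.+ (b ℚ.- d)
  regroup a b c d = trans
    (cong (a ℚ.+ b ℚ.+_) (ℚ.neg-distrib-+ c d))
    (interchange a b (ℚ.- c) (ℚ.- d))

infixl 6 _+_

_+_ : ℝ → ℝ → ℝ
x + y = mkℝ (λ n → seq x n ℚ.+ seq y n) λ ε 0<ε →
  let (M , p) = cauchy x (ε ℚ.* ½) (half-pos ε 0<ε)
      (N , q) = cauchy y (ε ℚ.* ½) (half-pos ε 0<ε)
  in M ℕ.⊔ N , λ m n M⊔N≤m M⊔N≤n →
    let open ℚ.≤-Reasoning in begin-strict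
      ∣ (seq x m ℚ.+ seq y m) ℚ.- (seq x n ℚ.+ seq y n) ∣
        ≡⟨ cong ∣_∣ (regroup (seq x m) (seq y m) (seq x n) (seq y n)) ⟩
      ∣ (seq x m ℚ.- seq x n) ℚ.+ (seq y m ℚ.- seq y n) ∣
        ≤⟨ ℚ.∣p+q∣≤∣p∣+∣q∣ (seq x m ℚ.- seq x n) (seq y m ℚ.- seq y n) ⟩
      ∣ seq x m ℚ.- seq x n ∣ ℚ.+ ∣ seq y m ℚ.- seq y n ∣
        <⟨ ℚ.+-mono-<
             (p m n (ℕ.≤-trans (ℕ.m≤m⊔n M N) M⊔N≤m) (ℕ.≤-trans (ℕ.m≤m⊔n M N) M⊔N≤n))
             (q m n (ℕ.≤-trans (ℕ.m≤n⊔m M N) M⊔N≤m) (ℕ.≤-trans (ℕ.m≤n⊔m M N) M⊔N≤n)) ⟩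
      ε ℚ.* ½ ℚ.+ ε ℚ.* ½
        ≡⟨ half+half ε ⟩
      ε ∎

-- Equality of subsets is `_≐_`.

𝒫 : Set → Set₁
𝒫 X = Pred X 0ℓ

Family : Set → Set₁
Family X = Pred (𝒫 X) 0ℓ

IsFinite : Pred ℕ 0ℓ → Set
IsFinite S = ∃[ xs ] ∀ {n} → n ∈ S → n List.∈ xs

infix 4 _⟶ω

-- Functions A → ω on a subset A of ω; the membership proof is irrelevant, so
-- the value depends on the point only.
_⟶ω : 𝒫 ℕ → Set
A ⟶ω = ∀ n → .(n ∈ A) → ℕ

preimage : ∀ {A} → A ⟶ω → 𝒫 ℕ → 𝒫 ℕ
preimage {A} f B = λ n → Σ[ n∈A ∈ n ∈ A ] f n n∈A ∈ B

record IsIdeal (𝒥 : Family ℕ) : Set₁ where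
  field
    ∪-closed : ∀ {S T} → S ∈ 𝒥 → T ∈ 𝒥 → S ∪ T ∈ 𝒥
    ⊆-closed : ∀ {S T} → S ⊆ T → T ∈ 𝒥 → S ∈ 𝒥
    finite   : ∀ {S} → IsFinite S → S ∈ 𝒥
    proper   : U ∉ 𝒥

infix 8 _↾_

_↾_ : Family ℕ → 𝒫 ℕ → Pred (𝒫 ℕ) (lsuc 0ℓ)
(𝒥 ↾ A) S = Σ[ B ∈ 𝒫 ℕ ] B ∈ 𝒥 × S ≐ B ∩ A

Tall : Family ℕ → Set₁
Tall 𝓘 = ∀ S → ¬ IsFinite S →
  Σ[ T ∈ 𝒫 ℕ ] T ⊆ S × ¬ IsFinite T × T ∈ 𝓘

sum : (ℕ → ℝ) → List ℕ → ℝ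
sum g = foldr (λ n s → g n + s) 0ℝ

-- For g ≥ 0, the sum of g over A is finite iff the sums over the finite
-- subsets of A are bounded.
Summable : (ℕ → ℝ) → Family ℕ
Summable g A = Σ[ M ∈ ℝ ] ∀ xs → Unique xs → All A xs → sum g xs ≤ M

record IsWeight (g : ℕ → ℝ) : Set where
  field
    nonNegative : ∀ n → 0ℝ ≤ g n
    divergent   : U ∉ Summable g

ContainsTallSummable : Family ℕ → Set₁
ContainsTallSummable ℐ =
  Σ[ g ∈ (ℕ → ℝ) ] IsWeight g × Tall (Summable g) × Summable g ⊆ ℐ

-- 𝒥 ↾ A is ≤_K-above 𝓘
KAbove : Family ℕ → 𝒫 ℕ → Family ℕ → Set₁
KAbove 𝒥 A 𝓘 = Σ[ f ∈ A ⟶ω ] (∀ B → B ∈ 𝓘 → preimage f B ∈ 𝒥 ↾ A)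

NotKAboveTallSummable : Family ℕ → 𝒫 ℕ → Set₁
NotKAboveTallSummable 𝒥 A =
  ∀ g → IsWeight g → Tall (Summable g) → ¬ KAbove 𝒥 A (Summable g)

-- The product topology of {0,1}^ω: membership in an open set is secured by
-- a finite initial segment.
IsOpen : Family ℕ → Set₁
IsOpen 𝒰 = ∀ S → S ∈ 𝒰 →
  ∃[ N ] ∀ (T : 𝒫 ℕ) → (∀ n → n ℕ.< N → n ∈ S ⇔ n ∈ T) → T ∈ 𝒰

data IsBorel : Family ℕ → Set₁ where
  open-set   : ∀ {𝒰} → IsOpen 𝒰 → IsBorel 𝒰
  complement : ∀ {𝒰} → IsBorel 𝒰 → IsBorel (∁ 𝒰)
  union      : ∀ {𝒰 : ℕ → Family ℕ} → (∀ n → IsBorel (𝒰 n)) → IsBorel (⋃ ℕ 𝒰)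
  resp-≐     : ∀ {𝒰 𝒱} → 𝒰 ≐ 𝒱 → IsBorel 𝒰 → IsBorel 𝒱

-- Finite subsets of ω are listed by their elements, possibly with repetitions.
FinSet : Set
FinSet = List ℕ

card : FinSet → ℕ
card F = length (deduplicate ℕ._≟_ F)

-- A strategy of Player I: `respond (G₀ ∷ … ∷ Gₙ ∷ [])` is (Fₙ , kₙ₊₁); the value
-- at [] is never used.
record StrategyI : Set where
  field
    k₀      : ℕ
    respond : List FinSet → FinSet × ℕ

module Play (σ : StrategyI) (G : ℕ → FinSet) where
  open StrategyI σ

  F : ℕ → FinSet
  F n = proj₁ (respond (applyUpTo G (suc n)))

  k : ℕ → ℕ
  k zero    = k₀
  k (suc n) = proj₂ (respond (applyUpTo G (suc n)))

  Legal : Set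
  Legal = ∀ n → (∀ m → m List.∈ F n → ¬ m List.∈ G n) × card (F n) ℕ.≤ k n

  ⋃F : 𝒫 ℕ
  ⋃F m = ∃[ n ] m List.∈ F n

IsWinningI : (𝒥 : Family ℕ) (A : 𝒫 ℕ) → A ⟶ω → StrategyI → Set₁
IsWinningI 𝒥 A f σ = ∀ G → let open Play σ G in
  Legal × preimage f ⋃F ∉ 𝒥 ↾ A

_-to-one : Family ℕ → ∀ {A} → A ⟶ω → Set
(𝒥 -to-one) f = ∀ n → preimage f ｛ n ｝ ∈ 𝒥

PlayerIWinsAll : Family ℕ → Set₁
PlayerIWinsAll 𝒥 = ∀ A → A ∉ 𝒥 → (f : A ⟶ω) → (𝒥 -to-one) f →
  Σ[ σ ∈ StrategyI ] IsWinningI 𝒥 A f σ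

-- Cardinals.  A cardinal is represented by a type of that cardinality, and
-- κ ≤ μ means that there is an injection κ ↣ μ.

HasCardinality : ∀ {X} → Family X → Set → Set₁
HasCardinality {X} 𝒞 κ = Σ[ e ∈ (κ → 𝒫 X) ]
  (∀ i → e i ∈ 𝒞) ×
  (∀ i j → e i ≐ e j → i ≡ j) ×
  (∀ S → S ∈ 𝒞 → ∃[ i ] e i ≐ S)

-- κ is the minimum of the class 𝒮 of cardinals.
IsMinimum : ∀ {ℓ} → (Set → Set ℓ) → Set → Set (lsuc 0ℓ ⊔ ℓ)
IsMinimum 𝒮 κ = 𝒮 κ × (∀ μ → 𝒮 μ → κ ↣ μ)

-- A cardinal defined as a minimum is the predicate satisfied by exactly the types
-- of that cardinality.  Under excluded middle and function extensionality,
-- cardinals are well-ordered and such types exist for every nonempty class.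
infix 4 _≤ᶜ_

_≤ᶜ_ : ∀ {ℓ₁ ℓ₂} → (Set → Set ℓ₁) → (Set → Set ℓ₂) → Set (lsuc 0ℓ ⊔ ℓ₁ ⊔ ℓ₂)
P ≤ᶜ Q = ∀ κ μ → P κ → Q μ → κ ↣ μ

𝔠 : Set
𝔠 = ℕ → Bool

-- The least cardinal strictly above 𝔠.
𝔠⁺ : Set → Set₁
𝔠⁺ = IsMinimum (λ κ → 𝔠 ↣ κ × ¬ (κ ↣ 𝔠))

-- The order topology of ℝ; nowhere dense: the closure has empty interior.
closure : 𝒫 ℝ → 𝒫 ℝ
closure S x = ∀ a b → a < x → x < b → ∃[ y ] y ∈ S × a < y × y < b

NowhereDense : 𝒫 ℝ → Set
NowhereDense S = ∀ a b → a < b → ¬ (∀ x → a < x → x < b → x ∈ closure S)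

-- Subsets of the real line respect `_≃_`.
Meager : 𝒫 ℝ → Set₁
Meager S = S Respects _≃_ ×
  (Σ[ N ∈ (ℕ → 𝒫 ℝ) ] (∀ n → NowhereDense (N n)) × S ≐ ⋃ ℕ N)

cov-ℳ : Set → Set₁
cov-ℳ = IsMinimum λ κ → Σ[ 𝒞 ∈ Family ℝ ]
  HasCardinality 𝒞 κ ×
  (∀ S → S ∈ 𝒞 → Meager S) ×
  (∀ x → Σ[ S ∈ 𝒫 ℝ ] S ∈ 𝒞 × x ∈ S)

-- The intersection of the empty list is ω.
⋂ᶠ : List (𝒫 ℕ) → 𝒫 ℕ
⋂ᶠ = foldr _∩_ U

record HasFIP (𝒥 𝒜 : Family ℕ) : Set₁ where
  field
    nonempty : ∃[ S ] S ∈ 𝒜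
    fip      : ∀ F → All 𝒜 F → ⋂ᶠ F ∉ 𝒥

𝔣𝔦𝔭 : Family ℕ → Family ℕ → Pred (ℕ → ℕ) 0ℓ → Set → Set₁
𝔣𝔦𝔭 ℐ 𝒥 ℱ = IsMinimum λ κ → 𝔠⁺ κ ⊎ (Σ[ 𝒜 ∈ Family ℕ ]
  HasCardinality 𝒜 κ ×
  HasFIP 𝒥 𝒜 ×
  ¬ (∀ f → f ∈ ℱ → Σ[ B ∈ 𝒫 ℕ ] B ∈ ℐ × HasFIP 𝒥 (𝒜 ∪ (_≐ (f ⊢ B)))))

{-# OPTIONS --safe #-}
module Submission where

-- Let 𝒜 be a family of fewer than cov(ℳ) sets with the 𝒥⁺-FIP and let f : ω → ω.
-- A set B ∈ ℐ is needed such that f⁻¹[B] is positive on every finite intersection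
-- A of members of 𝒜. If on some A finitely many values of f suffice modulo 𝒥,
-- then these values form such a set B. Otherwise Player I has, for every A, a
-- strategy in the game whose outcomes ⋃ Fₙ all satisfy f⁻¹[⋃ Fₙ] ∩ A ∉ 𝒥: either
-- infinitely many fibers of f are positive on A and Player I plays one of them,
-- or f is 𝒥-to-one on A off finitely many fibers (`wins-on`). Let B be the union
-- of a generic sequence of finite sets s j of weight at most 2⁻ʲ, which belongs to
-- the tall summable ideal (`thin⇒summable`). For a strategy, a history t and an
-- index j, Player II can play all points of large weight and so force a response
-- that is admissible as s j. If for every strategy and every t some s j is this
-- response, then B contains an outcome of every strategy (`B-positive`).
--
-- Thus a sequence in ω^ω is needed that meets |𝒜| many given sequences, each of
-- them in at least one argument. Such a sequence is read off from a real number
-- outside as many meager sets (`cov-≤-or-guessing`): if the j-th rational interval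
-- contains the disjoint cells c(j,0), c(j,1), …, then the reals that belong to no
-- cell c(j, φ j) form a nowhere dense set. The number of strategies and histories
-- is that of finite sequences from 𝒜, which is |𝒜| for infinite 𝒜 by Hessenberg's
-- theorem, proved by Zorn's lemma (`List-↣-infinite`); for countably many
-- sequences no genericity is needed.
--
-- For a Borel ideal 𝒥 the game need not be analysed by Borel determinacy. Borel
-- sets are projections of closed subsets of P(ω) × ω^ω (`borel⇒analytic`), so the
-- game has an unfolding, in which Player II also produces a witness for the
-- membership of the outcome in 𝒥, that is open for Player I and hence determined.
-- If Player I wins the unfolded game, then Player I wins the original one by
-- simulating the plays for all possible witnesses simultaneously, with delays
-- which keep the number of simulated plays finite (`Simulation.winning`). If not,
-- then Player II has a strategy. Choose consecutive intervals, the t-th one with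
-- at least 2ᵗ points, so long that the answers to moves below one interval end
-- below the next one, and give weight 2⁻ᵗ to the points of the t-th one. A set B of
-- finite weight has fewer than 2ᵗ points in almost all intervals. Hence its parts
-- in every other interval are legal moves of Player I, and the strategy shows that
-- the preimages of the two halves of B belong to 𝒥. So f witnesses that 𝒥 ↾ A is
-- above a tall summable ideal (`K-above`), against the hypothesis.

open import Defs
open import Axiom.ExcludedMiddle using (ExcludedMiddle)
open import Axiom.Extensionality.Propositional using (Extensionality)
open import Axiom.UniquenessOfIdentityProofs.WithK using (uip)
open import Data.Bool.Base using (Bool; true; false; if_then_else_)
open import Data.Empty using (⊥; ⊥-elim)
open import Data.Integer.Base as ℤ using (ℤ)
import Data.Integer.Properties as ℤ
open import Data.List.Base
  using (List; []; _∷_; [_]; _∷ʳ_; _++_; length; map; concat; concatMap; foldr; filter;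
         deduplicate; applyUpTo; upTo; applyDownFrom)
import Data.List.Membership.Propositional as List
import Data.List.Membership.Propositional.Properties as List
import Data.List.Properties as List
open import Data.List.Relation.Unary.All as All using (All; []; _∷_)
import Data.List.Relation.Unary.All.Properties as All
open import Data.List.Relation.Unary.AllPairs using ([]; _∷_)
open import Data.List.Relation.Unary.Any using (here; there)
open import Data.List.Relation.Unary.Unique.Propositional using (Unique)
import Data.List.Relation.Unary.Unique.Propositional.Properties as Unique
open import Data.Nat.Base as ℕ using (ℕ; zero; suc)
import Data.Nat.Properties as ℕ
import Data.List.Relation.Unary.Unique.DecPropositional.Properties ℕ._≟_ as Dedup
open import Data.Product using (_×_; _,_; proj₁; proj₂; Σ-syntax)
open import Data.Rational.Base as ℚ using (ℚ; mkℚ; 0ℚ; 1ℚ; ½; ∣_∣)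
import Data.Rational.Properties as ℚ
open import Data.Rational.Solver using (module +-*-Solver)
open import Data.Rational.Unnormalised.Base as ℚᵘ using (mkℚᵘ)
import Data.Rational.Unnormalised.Properties as ℚᵘ
open import Algebra.Definitions.RawMonoid ℚ.+-0-rawMonoid using () renaming (_×_ to _·_)
import Algebra.Properties.CommutativeMonoid.Mult ℚ.+-0-commutativeMonoid as Mult
open import Data.Sum.Base as Sum using (_⊎_; inj₁; inj₂)
open import Data.Unit.Base using (tt)
open import Function.Base using (_∘_; case_of_)
open import Function.Bundles using (_↣_; _⇔_; mk↣; mk⇔; Injection; Equivalence)
open import Function.Construct.Composition using (_↣-∘_)
open import Level using (Lift; lift; lower)
open import Relation.Binary.Definitions using (tri<; tri≈; tri>)
open import Relation.Binary.PropositionalEquality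
  using (_≡_; _≢_; refl; cong; cong₂; sym; trans; subst; module ≡-Reasoning)
open import Relation.Nullary using (¬_; Dec; yes; no; does)
open import Relation.Nullary.Decidable using (decidable-stable; ⌊_⌋)
open import Relation.Unary using (_∈_; _∉_; _⊆_; _≐_; _∪_; _∩_; _⊢_; ∁; ｛_｝; U; ⋃)

module Classical (em : ∀ {ℓ} → ExcludedMiddle ℓ) (fe : ∀ {a b} → Extensionality a b) where

  -- Classical logic

  -- Excluded middle for all types acts as a choice principle: the double negation
  -- of a Σ-type yields a witness.

  dne : ∀ {ℓ} {P : Set ℓ} → ¬ ¬ P → P
  dne = decidable-stable em

  ¬∀⇒∃¬ : ∀ {a b} {A : Set a} {P : A → Set b} → ¬ (∀ x → P x) → Σ[ x ∈ A ] ¬ P x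
  ¬∀⇒∃¬ h = dne λ k → h λ x → dne λ ¬p → k (x , ¬p)

  ¬∀¬⇒∃ : ∀ {a b} {A : Set a} {P : A → Set b} → ¬ (∀ x → ¬ P x) → Σ[ x ∈ A ] P x
  ¬∀¬⇒∃ h = dne λ k → h λ x p → k (x , p)

  ¬→⇒×¬ : ∀ {a b} {A : Set a} {B : Set b} → ¬ (A → B) → A × ¬ B
  ¬→⇒×¬ h = dne (λ k → h λ a → ⊥-elim (k a)) , λ b → h λ _ → b

  -- The truth value of a proposition. Equivalent propositions have equal truth
  -- values, which makes choices depend on subsets only up to extensional equality.
  ⟦_⟧ : ∀ {ℓ} → Set ℓ → Bool
  ⟦ P ⟧ = does (em {P = P})

  ⟦⟧-true : ∀ {ℓ} {P : Set ℓ} → P → ⟦ P ⟧ ≡ true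
  ⟦⟧-true {P = P} p with em {P = P}
  ... | yes _ = refl
  ... | no ¬p = ⊥-elim (¬p p)

  true-⟦⟧ : ∀ {ℓ} {P : Set ℓ} → ⟦ P ⟧ ≡ true → P
  true-⟦⟧ {P = P} eq with em {P = P}
  ... | yes p = p
  ... | no _ with () ← eq

  bool-ext : ∀ {b c : Bool} → (b ≡ true → c ≡ true) → (c ≡ true → b ≡ true) → b ≡ c
  bool-ext {false} {false} f g = refl
  bool-ext {true}  {true}  f g = refl
  bool-ext {true}  {false} f g = sym (f refl)
  bool-ext {false} {true}  f g = g refl

  -- Zorn's lemma

  module _ {T : Set} where

    -- Subsets of T are characteristic functions, so that inclusion is
    -- antisymmetric and a class of subsets is again small.
    Sub : Set
    Sub = T → Bool

    infix 4 _⊑_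

    _⊑_ : Sub → Sub → Set
    s ⊑ s′ = ∀ t → s t ≡ true → s′ t ≡ true

    ⊑-antisym : ∀ {s s′} → s ⊑ s′ → s′ ⊑ s → s ≡ s′
    ⊑-antisym p q = fe λ t → bool-ext (p t) (q t)

    ⋁ : (Sub → Set) → Sub
    ⋁ C t = ⟦ Σ[ s ∈ Sub ] C s × s t ≡ true ⟧

    ⊑-⋁ : ∀ {C s} → C s → s ⊑ ⋁ C
    ⊑-⋁ c t st = ⟦⟧-true (_ , c , st)

    ⋁-⊑ : ∀ {C s} → (∀ u → C u → u ⊑ s) → ⋁ C ⊑ s
    ⋁-⊑ h t st = let (u , c , ut) = true-⟦⟧ st in h u c t ut

    IsChain : (Sub → Set) → Set
    IsChain C = ∀ s s′ → C s → C s′ → s ⊑ s′ ⊎ s′ ⊑ s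

    -- Two elements of the union of a chain lie in a common member.
    common-member : ∀ {C} → IsChain C → ∀ t t′ → ⋁ C t ≡ true → ⋁ C t′ ≡ true →
      Σ[ s ∈ Sub ] C s × s t ≡ true × s t′ ≡ true
    common-member ch t t′ p p′ with true-⟦⟧ p | true-⟦⟧ p′
    ... | (s , c , st) | (s′ , c′ , s′t′) with ch s s′ c c′
    ... | inj₁ le = s′ , c′ , le t st , s′t′
    ... | inj₂ le = s , c , st , le t′ s′t′

    module Zorn (base : Sub) (Good : Sub → Set) where

      -- m is good and strictly larger than s.
      Larger : Sub → Sub → Set
      Larger s m = Good m × s ⊑ m × ¬ m ⊑ s

      -- A strictly larger good set, if there is one.
      next : Sub → Sub
      next s with em {P = Σ[ m ∈ Sub ] Larger s m}
      ... | yes (m , _) = m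
      ... | no _        = s

      ⊑-next : ∀ s → s ⊑ next s
      ⊑-next s with em {P = Σ[ m ∈ Sub ] Larger s m}
      ... | yes (m , _ , le , _) = le
      ... | no _                 = λ _ p → p

      next-good : ∀ s → Good s → Good (next s)
      next-good s gs with em {P = Σ[ m ∈ Sub ] Larger s m}
      ... | yes (m , gm , _) = gm
      ... | no _             = gs

      next-larger : ∀ s {m} → Larger s m → ¬ next s ⊑ s
      next-larger s l with em {P = Σ[ m ∈ Sub ] Larger s m}
      ... | yes (_ , _ , _ , nle) = nle
      ... | no none               = λ _ → none (_ , l)

      -- The successors of the members of C, and the base.
      Successors : (Sub → Bool) → Sub → Set
      Successors C u = u ≡ base ⊎ (Σ[ s ∈ Sub ] C s ≡ true × u ≡ next s)

      -- The sets reached from the base by transfinitely iterating `next`. Successor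
      -- and limit stages are merged: a stage is the union of the successors of the
      -- chosen earlier stages.
      data Tower : Sub → Set where
        lim : ∀ C → (∀ s → C s ≡ true → Tower s) → Tower (⋁ (Successors C))

      base-⊑ : ∀ {s} → Tower s → base ⊑ s
      base-⊑ (lim C _) = ⊑-⋁ {Successors C} (inj₁ refl)

      -- One half of the comparison of a stage with y.
      compare-⋁ : ∀ C y → base ⊑ y →
        (∀ s → C s ≡ true → (s ⊑ y ⊎ next y ⊑ s) × (y ⊑ s ⊎ next s ⊑ y)) →
        ⋁ (Successors C) ⊑ y ⊎ next y ⊑ ⋁ (Successors C)
      compare-⋁ C y b h with em {P = ∀ u → Successors C u → u ⊑ y}
      ... | yes below = inj₁ (⋁-⊑ {Successors C} below)
      ... | no ¬below with ¬∀⇒∃¬ ¬below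
      ... | (u , ¬u) with ¬→⇒×¬ ¬u
      ... | (inj₁ refl , nle) = ⊥-elim (nle b)
      ... | (inj₂ (s , c , refl) , nle) with h s c
      ... | (_ , inj₂ le) = ⊥-elim (nle le)
      ... | (inj₂ le , inj₁ _) =
        inj₂ λ t p → ⊑-⋁ {Successors C} (inj₂ (s , c , refl)) t (⊑-next s t (le t p))
      ... | (inj₁ le , inj₁ ge) = inj₂ λ t p →
        ⊑-⋁ {Successors C} (inj₂ (s , c , refl)) t
          (subst (λ z → next z t ≡ true) (⊑-antisym ge le) p)

      -- Hence the tower is a chain on which `next` is monotone.
      compare : ∀ {x y} → Tower x → Tower y → (x ⊑ y ⊎ next y ⊑ x) × (y ⊑ x ⊎ next x ⊑ y)
      compare tx@(lim C f) ty@(lim D g) =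
        compare-⋁ C _ (base-⊑ ty) (λ s c → compare (f s c) ty) ,
        compare-⋁ D _ (base-⊑ tx) (λ s d → let (p , q) = compare tx (g s d) in q , p)

      successors-chain : ∀ {C} → (∀ s → C s ≡ true → Tower s) → IsChain (Successors C)
      successors-chain f _ _ (inj₁ refl) (inj₁ refl) = inj₁ λ _ p → p
      successors-chain f _ _ (inj₁ refl) (inj₂ (s , c , refl)) =
        inj₁ λ t p → ⊑-next s t (base-⊑ (f s c) t p)
      successors-chain f _ _ (inj₂ (s , c , refl)) (inj₁ refl) =
        inj₂ λ t p → ⊑-next s t (base-⊑ (f s c) t p)
      successors-chain f _ _ (inj₂ (s , c , refl)) (inj₂ (s′ , c′ , refl))
        with compare (f s c) (f s′ c′)
      ... | (inj₂ le , _) = inj₂ λ t p → ⊑-next s t (le t p)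
      ... | (_ , inj₂ le) = inj₁ λ t p → ⊑-next s′ t (le t p)
      ... | (inj₁ le , inj₁ ge) = inj₁ λ t → subst (λ z → next z t ≡ true) (⊑-antisym le ge)

      -- The union of the tower belongs to the tower, hence contains its successor.
      zorn : Good base →
        (∀ C → C base → (∀ s → C s → Good s) → IsChain C → Good (⋁ C)) →
        Σ[ m ∈ Sub ] base ⊑ m × Good m × (∀ m′ → Good m′ → m ⊑ m′ → m′ ⊑ m)
      zorn good-base good-⋁ =
        top , base-⊑ tower-top , tower-good tower-top ,
        λ m′ gm′ le → dne λ nle → next-larger top (gm′ , le , nle)
          (⊑-⋁ {Successors all} (inj₂ (top , ⟦⟧-true tower-top , refl)))
        where
        tower-good : ∀ {s} → Tower s → Good s
        tower-good (lim C f) = good-⋁ (Successors C) (inj₁ refl)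
          (λ { _ (inj₁ refl) → good-base
             ; _ (inj₂ (s , c , refl)) → next-good s (tower-good (f s c)) })
          (successors-chain f)

        all : Sub → Bool
        all s = ⟦ Tower s ⟧

        top : Sub
        top = ⋁ (Successors all)

        tower-top : Tower top
        tower-top = lim all λ _ → true-⟦⟧

  -- Cardinal arithmetic

  module _ (X Y : Set) where

    -- The graph of a partial injection.
    Matching : (X × Y → Bool) → Set
    Matching s = ∀ x y x′ y′ → s (x , y) ≡ true → s (x′ , y′) ≡ true →
      (x ≡ x′ → y ≡ y′) × (y ≡ y′ → x ≡ x′)

    matching-⋁ : ∀ C → C (λ _ → false) → (∀ s → C s → Matching s) → IsChain C →
      Matching (⋁ C)
    matching-⋁ C _ good ch x y x′ y′ p p′ =
      let (s , c , q , q′) = common-member ch (x , y) (x′ , y′) p p′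
      in good s c x y x′ y′ q q′

    -- Any two cardinals are comparable: a maximal partial injection is total on
    -- one side.
    ↣-total : (X ↣ Y) ⊎ (Y ↣ X)
    ↣-total with Zorn.zorn (λ _ → false) Matching (λ _ _ _ _ ()) matching-⋁
    ... | (m , _ , match , maximal) with em {P = ∀ x → Σ[ y ∈ Y ] m (x , y) ≡ true}
    ... | yes left = inj₁ (mk↣ {to = proj₁ ∘ left} λ {x} {x′} →
            proj₂ (match x _ x′ _ (proj₂ (left x)) (proj₂ (left x′))))
    ... | no ¬left with em {P = ∀ y → Σ[ x ∈ X ] m (x , y) ≡ true}
    ... | yes right = inj₂ (mk↣ {to = proj₁ ∘ right} λ {y} {y′} →
            proj₁ (match _ y _ y′ (proj₂ (right y)) (proj₂ (right y′))))
    ... | no ¬right = ⊥-elim (free-x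
      (y₀ , maximal m⁺ match⁺ (λ _ p → ⟦⟧-true (inj₁ p)) _ (⟦⟧-true (inj₂ refl))))
      where
      x₀ = proj₁ (¬∀⇒∃¬ ¬left)
      free-x = proj₂ (¬∀⇒∃¬ ¬left)
      y₀ = proj₁ (¬∀⇒∃¬ ¬right)
      free-y = proj₂ (¬∀⇒∃¬ ¬right)

      m⁺ : X × Y → Bool
      m⁺ t = ⟦ m t ≡ true ⊎ t ≡ (x₀ , y₀) ⟧

      match⁺ : ∀ x y x′ y′ → m⁺ (x , y) ≡ true → m⁺ (x′ , y′) ≡ true →
        (x ≡ x′ → y ≡ y′) × (y ≡ y′ → x ≡ x′)
      match⁺ x y x′ y′ p p′ with true-⟦⟧ p | true-⟦⟧ p′
      ... | inj₁ q | inj₁ q′ = match x y x′ y′ q q′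
      ... | inj₂ refl | inj₂ refl = (λ _ → refl) , (λ _ → refl)
      ... | inj₁ q | inj₂ refl =
        (λ { refl → ⊥-elim (free-x (_ , q)) }) , λ { refl → ⊥-elim (free-y (_ , q)) }
      ... | inj₂ refl | inj₁ q′ =
        (λ { refl → ⊥-elim (free-x (_ , q′)) }) , λ { refl → ⊥-elim (free-y (_ , q′)) }

  ,-injective : ∀ {A B : Set} {a a′ : A} {b b′ : B} → (a , b) ≡ (a′ , b′) → a ≡ a′ × b ≡ b′
  ,-injective refl = refl , refl

  -- A pairing function: the pairs with sum s are coded by the numbers from s² to s² + s.
  pair : ℕ → ℕ → ℕ
  pair a b = (a ℕ.+ b) ℕ.* (a ℕ.+ b) ℕ.+ a

  pair-mono-sum : ∀ a b a′ b′ → a ℕ.+ b ℕ.< a′ ℕ.+ b′ → pair a b ℕ.< pair a′ b′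
  pair-mono-sum a b a′ b′ lt = begin-strict
    s ℕ.* s ℕ.+ a      ≤⟨ ℕ.+-monoʳ-≤ (s ℕ.* s) (ℕ.m≤m+n a b) ⟩
    s ℕ.* s ℕ.+ s      <⟨ ℕ.n<1+n _ ⟩
    suc (s ℕ.* s ℕ.+ s)
      ≤⟨ ℕ.s≤s (ℕ.≤-trans (ℕ.≤-reflexive (ℕ.+-comm (s ℕ.* s) s))
           (ℕ.+-monoʳ-≤ s (ℕ.*-monoʳ-≤ s (ℕ.n≤1+n s)))) ⟩
    suc s ℕ.* suc s    ≤⟨ ℕ.*-mono-≤ lt lt ⟩
    s′ ℕ.* s′          ≤⟨ ℕ.m≤m+n _ a′ ⟩
    s′ ℕ.* s′ ℕ.+ a′   ∎
    where
    open ℕ.≤-Reasoning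
    s = a ℕ.+ b
    s′ = a′ ℕ.+ b′

  pair-injective : ∀ a b a′ b′ → pair a b ≡ pair a′ b′ → a ≡ a′ × b ≡ b′
  pair-injective a b a′ b′ eq with ℕ.<-cmp (a ℕ.+ b) (a′ ℕ.+ b′)
  ... | tri< lt _ _ = ⊥-elim (ℕ.<⇒≢ (pair-mono-sum a b a′ b′ lt) eq)
  ... | tri> _ _ gt = ⊥-elim (ℕ.<⇒≢ (pair-mono-sum a′ b′ a b gt) (sym eq))
  ... | tri≈ _ s≡s′ _ = a≡a′ ,
    ℕ.+-cancelˡ-≡ a b b′ (trans s≡s′ (cong (ℕ._+ b′) (sym a≡a′)))
    where
    a≡a′ : a ≡ a′
    a≡a′ = ℕ.+-cancelˡ-≡ ((a ℕ.+ b) ℕ.* (a ℕ.+ b)) a a′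
      (trans eq (cong (λ z → z ℕ.* z ℕ.+ a′) (sym s≡s′)))

  ℕ×ℕ↣ℕ : (ℕ × ℕ) ↣ ℕ
  ℕ×ℕ↣ℕ = mk↣ {to = λ (a , b) → pair a b} λ {(a , b)} {(a′ , b′)} eq →
    let (p , q) = pair-injective a b a′ b′ eq in cong₂ _,_ p q

  -- Hessenberg's theorem. A good set codes a subset D of X together with the
  -- graph R of an injection D × D → D; functionality of R is not needed.
  module Hessenberg {X : Set} (ι : ℕ ↣ X) where

    open Injection ι using () renaming (to to ι₀; injective to ι-injective)

    T : Set
    T = X ⊎ (X × X × X)

    D : (T → Bool) → X → Set
    D s a = s (inj₁ a) ≡ true

    R : (T → Bool) → X → X → X → Set
    R s a b c = s (inj₂ (a , b , c)) ≡ true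

    record Good (s : T → Bool) : Set where
      field
        total     : ∀ a b → D s a → D s b → Σ[ c ∈ X ] R s a b c
        injective : ∀ a b a′ b′ c → R s a b c → R s a′ b′ c → (a , b) ≡ (a′ , b′)
        closed    : ∀ a b c → R s a b c → D s c
    open Good

    -- The base is the pairing function, transported to the image of ω.
    InBase : T → Set
    InBase (inj₁ a)           = Σ[ n ∈ ℕ ] a ≡ ι₀ n
    InBase (inj₂ (a , b , c)) = Σ[ m ∈ ℕ ] Σ[ n ∈ ℕ ] a ≡ ι₀ m × b ≡ ι₀ n × c ≡ ι₀ (pair m n)

    base : T → Bool
    base t = ⟦ InBase t ⟧

    good-base : Good base
    good-base .total a b p q with true-⟦⟧ p | true-⟦⟧ q
    ... | (m , refl) | (n , refl) = _ , ⟦⟧-true (m , n , refl , refl , refl)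
    good-base .injective a b a′ b′ c p q with true-⟦⟧ p | true-⟦⟧ q
    ... | (m , n , refl , refl , eq) | (m′ , n′ , refl , refl , eq′)
      with pair-injective m n m′ n′ (ι-injective (trans (sym eq) eq′))
    ... | (refl , refl) = refl
    good-base .closed a b c p with true-⟦⟧ p
    ... | (m , n , _ , _ , refl) = ⟦⟧-true (_ , refl)

    good-⋁ : ∀ C → C base → (∀ s → C s → Good s) → IsChain C → Good (⋁ C)
    good-⋁ C _ good ch .total a b p q =
      let (s , c , p′ , q′) = common-member ch _ _ p q
          (e , r) = total (good s c) a b p′ q′
      in e , ⊑-⋁ c _ r
    good-⋁ C _ good ch .injective a b a′ b′ e p q =
      let (s , c , p′ , q′) = common-member ch _ _ p q
      in injective (good s c) a b a′ b′ e p′ q′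
    good-⋁ C _ good ch .closed a b e p =
      let (s , c , p′ , _) = common-member ch _ _ p p
      in ⊑-⋁ c _ (closed (good s c) a b e p′)

    opaque
      maximal : Σ[ m ∈ (T → Bool) ] base ⊑ m × Good m × (∀ m′ → Good m′ → m ⊑ m′ → m′ ⊑ m)
      maximal = Zorn.zorn base Good good-base good-⋁

    m : T → Bool
    m = proj₁ maximal

    good-m : Good m
    good-m = proj₁ (proj₂ (proj₂ maximal))

    -- From now on D and R are those of a maximal good set m.
    Inside Outside : Set
    Inside  = Σ[ a ∈ X ] D m a
    Outside = Σ[ a ∈ X ] ¬ D m a

    inside-≡ : {p q : Inside} → proj₁ p ≡ proj₁ q → p ≡ q
    inside-≡ {_ , u} {_ , v} refl = cong (_ ,_) (uip u v)

    opaque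
      h : Inside → Inside → Inside
      h (a , p) (b , q) = let (c , r) = total good-m a b p q in c , closed good-m a b c r

      h-injective : ∀ {p q p′ q′} → h p q ≡ h p′ q′ → p ≡ p′ × q ≡ q′
      h-injective {a , p} {b , q} {a′ , p′} {b′ , q′} eq =
        inside-≡ (proj₁ ab) , inside-≡ (proj₂ ab)
        where
        ab : a ≡ a′ × b ≡ b′
        ab = ,-injective (injective good-m a b a′ b′ _ (proj₂ (total good-m a b p q))
          (subst (R m a′ b′) (sym (cong proj₁ eq)) (proj₂ (total good-m a′ b′ p′ q′))))

    d₀ d₁ : Inside
    d₀ = ι₀ 0 , proj₁ (proj₂ maximal) _ (⟦⟧-true (_ , refl))
    d₁ = ι₀ 1 , proj₁ (proj₂ maximal) _ (⟦⟧-true (_ , refl))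

    d₀≢d₁ : d₀ ≢ d₁
    d₀≢d₁ eq with () ← ι-injective (cong proj₁ eq)

    -- Two disjoint copies of D in D.
    tag : Inside ⊎ Inside → Inside
    tag (inj₁ p) = h d₀ p
    tag (inj₂ p) = h d₁ p

    tag-injective : ∀ {u v} → tag u ≡ tag v → u ≡ v
    tag-injective {inj₁ _} {inj₁ _} eq = cong inj₁ (proj₂ (h-injective eq))
    tag-injective {inj₂ _} {inj₂ _} eq = cong inj₂ (proj₂ (h-injective eq))
    tag-injective {inj₁ _} {inj₂ _} eq = ⊥-elim (d₀≢d₁ (proj₁ (h-injective eq)))
    tag-injective {inj₂ _} {inj₁ _} eq = ⊥-elim (d₀≢d₁ (sym (proj₁ (h-injective eq))))

    -- If the complement of D is at most as large as D, then so is X.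
    small-outside : Outside ↣ Inside → (X × X) ↣ X
    small-outside j = mk↣ {to = λ (a , b) → proj₁ (h (code a) (code b))} λ eq →
      let (p , q) = h-injective (inside-≡ eq)
      in cong₂ _,_ (code-injective p) (code-injective q)
      where
      side : X → Inside ⊎ Inside
      side a with em {P = D m a}
      ... | yes p = inj₁ (a , p)
      ... | no ¬p = inj₂ (Injection.to j (a , ¬p))

      side-injective : ∀ {a b} → side a ≡ side b → a ≡ b
      side-injective {a} {b} eq with em {P = D m a} | em {P = D m b}
      side-injective refl | yes p | yes q = refl
      side-injective eq | no ¬p | no ¬q = cong proj₁ (Injection.injective j (inj₂-injective eq))
        where
        inj₂-injective : ∀ {A B : Set} {x y : B} → inj₂ {A = A} x ≡ inj₂ y → x ≡ y
        inj₂-injective refl = refl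
      side-injective () | yes p | no ¬q
      side-injective () | no ¬p | yes q

      code : X → Inside
      code a = tag (side a)

      code-injective : ∀ {a b} → code a ≡ code b → a ≡ b
      code-injective eq = side-injective (tag-injective eq)

    -- Otherwise D has a copy j[D] outside D, and R extends to D ∪ j[D] with the
    -- new values in j[D], against maximality.
    large-outside : ¬ (Inside ↣ Outside)
    large-outside j = proj₂ (j₀ d₀) (maximal-m (inj₁ (proj₁ (j₀ d₀))) (⟦⟧-true (inj₂ (d₀ , refl))))
      where
      open Injection j using () renaming (to to j₀; injective to j-injective)

      j-≡ : ∀ {p q} → proj₁ (j₀ p) ≡ proj₁ (j₀ q) → p ≡ q
      j-≡ {p} {q} eq = j-injective (outside-≡ eq)
        where
        outside-≡ : {p q : Outside} → proj₁ p ≡ proj₁ q → p ≡ q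
        outside-≡ {_ , u} {_ , v} refl = cong (_ ,_) (fe λ x → ⊥-elim (u x))

      D⁺ : X → Set
      D⁺ a = D m a ⊎ (Σ[ p ∈ Inside ] a ≡ proj₁ (j₀ p))

      side : ∀ a → D⁺ a → Inside ⊎ Inside
      side a (inj₁ p)       = inj₁ (a , p)
      side a (inj₂ (p , _)) = inj₂ p

      side-injective : ∀ {a b} (u : D⁺ a) (v : D⁺ b) → side a u ≡ side b v → a ≡ b
      side-injective (inj₁ _) (inj₁ _) refl = refl
      side-injective (inj₂ (_ , refl)) (inj₂ (_ , refl)) refl = refl
      side-injective (inj₁ _) (inj₂ _) ()
      side-injective (inj₂ _) (inj₁ _) ()

      New : X → X → X → Set
      New a b c = Σ[ u ∈ D⁺ a ] Σ[ v ∈ D⁺ b ]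
        ¬ (D m a × D m b) × c ≡ proj₁ (j₀ (h (tag (side a u)) (tag (side b v))))

      In⁺ : T → Set
      In⁺ (inj₁ a)           = D⁺ a
      In⁺ (inj₂ (a , b , c)) = R m a b c ⊎ New a b c

      m⁺ : T → Bool
      m⁺ t = ⟦ In⁺ t ⟧

      m⊑m⁺ : m ⊑ m⁺
      m⊑m⁺ (inj₁ a) p = ⟦⟧-true (inj₁ p)
      m⊑m⁺ (inj₂ _) p = ⟦⟧-true (inj₁ p)

      good⁺ : Good m⁺
      good⁺ .total a b p q with em {P = D m a × D m b}
      ... | yes (p′ , q′) = let (c , r) = total good-m a b p′ q′ in c , ⟦⟧-true (inj₁ r)
      ... | no ¬pq = _ , ⟦⟧-true (inj₂ (true-⟦⟧ p , true-⟦⟧ q , ¬pq , refl))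
      good⁺ .injective a b a′ b′ c p q with true-⟦⟧ p | true-⟦⟧ q
      ... | inj₁ r | inj₁ r′ = injective good-m a b a′ b′ c r r′
      ... | inj₁ r | inj₂ (_ , _ , _ , refl) = ⊥-elim (proj₂ (j₀ _) (closed good-m a b _ r))
      ... | inj₂ (_ , _ , _ , refl) | inj₁ r = ⊥-elim (proj₂ (j₀ _) (closed good-m a′ b′ _ r))
      ... | inj₂ (u , v , _ , eq) | inj₂ (u′ , v′ , _ , eq′) =
        let (e , e′) = h-injective (j-≡ (trans (sym eq) eq′))
        in cong₂ _,_ (side-injective u u′ (tag-injective e))
                     (side-injective v v′ (tag-injective e′))
      good⁺ .closed a b c p with true-⟦⟧ p
      ... | inj₁ r = ⟦⟧-true (inj₁ (closed good-m a b c r))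
      ... | inj₂ (_ , _ , _ , eq) = ⟦⟧-true (inj₂ (_ , eq))

      maximal-m : m⁺ ⊑ m
      maximal-m = proj₂ (proj₂ (proj₂ maximal)) m⁺ good⁺ m⊑m⁺

    X×X↣X : (X × X) ↣ X
    X×X↣X with ↣-total Inside Outside
    ... | inj₁ j = ⊥-elim (large-outside j)
    ... | inj₂ j = small-outside j

  open Hessenberg using (X×X↣X)

  ×-↣ : ∀ {A B C E : Set} → A ↣ C → B ↣ E → (A × B) ↣ (C × E)
  ×-↣ i j = mk↣ {to = λ (a , b) → Injection.to i a , Injection.to j b} λ eq →
    let (p , q) = ,-injective eq in cong₂ _,_ (Injection.injective i p) (Injection.injective j q)

  -- Finite sequences are coded by iterated pairs, tagged by x₀ at the end.
  List-↣ : ∀ {A X : Set} → (X × X) ↣ X → (x₀ x₁ : X) → x₀ ≢ x₁ → A ↣ X → List A ↣ X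
  List-↣ {A} {X} p x₀ x₁ x₀≢x₁ i = mk↣ {to = code} (λ {xs} {ys} → code-injective xs ys)
    where
    open Injection p using () renaming (to to p₀; injective to p-injective)

    code : List A → X
    code []       = p₀ (x₀ , x₀)
    code (a ∷ as) = p₀ (x₁ , p₀ (Injection.to i a , code as))

    code-injective : ∀ xs ys → code xs ≡ code ys → xs ≡ ys
    code-injective [] [] _ = refl
    code-injective [] (_ ∷ _) eq = ⊥-elim (x₀≢x₁ (proj₁ (,-injective (p-injective eq))))
    code-injective (_ ∷ _) [] eq = ⊥-elim (x₀≢x₁ (sym (proj₁ (,-injective (p-injective eq)))))
    code-injective (x ∷ xs) (y ∷ ys) eq =
      let (e , e′) = ,-injective (p-injective (proj₂ (,-injective (p-injective eq))))
      in cong₂ _∷_ (Injection.injective i e) (code-injective xs ys e′)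

  List-↣ℕ : ∀ {A : Set} → A ↣ ℕ → List A ↣ ℕ
  List-↣ℕ = List-↣ ℕ×ℕ↣ℕ 0 1 λ ()

  id-↣ : ∀ {A : Set} → A ↣ A
  id-↣ = mk↣ λ eq → eq

  -- The number of finite sequences from an infinite set.
  List-↣-infinite : ∀ {X} → ℕ ↣ X → List X ↣ X
  List-↣-infinite ι = List-↣ (X×X↣X ι) (Injection.to ι 0) (Injection.to ι 1)
    (λ eq → case Injection.injective ι eq of λ ()) id-↣

  ℤ↣ℕ : ℤ ↣ ℕ
  ℤ↣ℕ = ℕ×ℕ↣ℕ ↣-∘ mk↣ {to = code} (λ {i} {j} → code-injective i j)
    where
    code : ℤ → ℕ × ℕ
    code (ℤ.+ n)    = 0 , n
    code ℤ.-[1+ n ] = 1 , n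

    code-injective : ∀ i j → code i ≡ code j → i ≡ j
    code-injective (ℤ.+ _) (ℤ.+ _) refl = refl
    code-injective ℤ.-[1+ _ ] ℤ.-[1+ _ ] refl = refl

  ℚ↣ℕ : ℚ ↣ ℕ
  ℚ↣ℕ = ℕ×ℕ↣ℕ ↣-∘ (×-↣ ℤ↣ℕ id-↣ ↣-∘
    mk↣ {to = λ q → ℚ.numerator q , ℚ.denominator-1 q} λ {p} {q} → code-injective p q)
    where
    code-injective : ∀ p q →
      (ℚ.numerator p , ℚ.denominator-1 p) ≡ (ℚ.numerator q , ℚ.denominator-1 q) → p ≡ q
    code-injective (mkℚ _ _ _) (mkℚ _ _ _) refl = refl

  -- A left inverse of an injection into ω, with a default value.
  decode : ∀ {A : Set} → A → A ↣ ℕ → ℕ → A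
  decode {A} a i n with em {P = Σ[ x ∈ A ] Injection.to i x ≡ n}
  ... | yes (x , _) = x
  ... | no _        = a

  decode-to : ∀ {A : Set} (a : A) (i : A ↣ ℕ) x → decode a i (Injection.to i x) ≡ x
  decode-to {A} a i x with em {P = Σ[ y ∈ A ] Injection.to i y ≡ Injection.to i x}
  ... | yes (_ , eq) = Injection.injective i eq
  ... | no none      = ⊥-elim (none (x , refl))

  -- Real numbers

  <⇒≱ℚ : ∀ {p q} → p ℚ.< q → ¬ q ℚ.≤ p
  <⇒≱ℚ p<q q≤p = ℚ.<-irrefl refl (ℚ.<-≤-trans p<q q≤p)

  ≤-cancelʳ : ∀ {a b} c → a ℚ.+ c ℚ.≤ b ℚ.+ c → a ℚ.≤ b
  ≤-cancelʳ {a} {b} c le with a ℚ.≤? b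
  ... | yes a≤b = a≤b
  ... | no a≰b = ⊥-elim (<⇒≱ℚ (ℚ.+-monoˡ-< c (ℚ.≰⇒> a≰b)) le)

  p<p+ε : ∀ p {ε} → 0ℚ ℚ.< ε → p ℚ.< p ℚ.+ ε
  p<p+ε p 0<ε = subst (ℚ._< p ℚ.+ _) (ℚ.+-identityʳ p) (ℚ.+-monoʳ-< p 0<ε)

  p≤p+ε : ∀ p {ε} → 0ℚ ℚ.< ε → p ℚ.≤ p ℚ.+ ε
  p≤p+ε p 0<ε = ℚ.<⇒≤ (p<p+ε p 0<ε)

  opaque
    fifth : ∀ {ε} → 0ℚ ℚ.< ε → Σ[ d ∈ ℚ ] 0ℚ ℚ.< d × d ℚ.+ d ℚ.+ d ℚ.+ d ℚ.+ d ≡ ε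
    fifth {ε} 0<ε = ε ℚ.* ⅕ ,
      subst (ℚ._< ε ℚ.* ⅕) (ℚ.*-zeroˡ ⅕) (ℚ.*-monoˡ-<-pos ⅕ 0<ε) ,
      solve 1 (λ e → e :* con ⅕ :+ e :* con ⅕ :+ e :* con ⅕ :+ e :* con ⅕ :+ e :* con ⅕ := e) refl ε
      where
      open +-*-Solver
      ⅕ : ℚ
      ⅕ = ℤ.+ 1 ℚ./ 5

    half : ∀ {ε} → 0ℚ ℚ.< ε → Σ[ d ∈ ℚ ] 0ℚ ℚ.< d × d ℚ.+ d ≡ ε
    half {ε} 0<ε = ε ℚ.* ½ ,
      subst (ℚ._< ε ℚ.* ½) (ℚ.*-zeroˡ ½) (ℚ.*-monoˡ-<-pos ½ 0<ε) ,
      solve 1 (λ e → e :* con ½ :+ e :* con ½ := e) refl ε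
      where open +-*-Solver

    cancel-sub : ∀ p q → p ℚ.+ (q ℚ.- p) ≡ q
    cancel-sub = solve 2 (λ p q → p :+ (q :- p) := q) refl
      where open +-*-Solver

  ∣p-q∣<ε⇒p<q+ε : ∀ {p q ε} → ∣ p ℚ.- q ∣ ℚ.< ε → p ℚ.< q ℚ.+ ε
  ∣p-q∣<ε⇒p<q+ε {p} {q} {ε} lt = begin-strict
    p                   ≡⟨ cancel-sub q p ⟨
    q ℚ.+ (p ℚ.- q)     ≤⟨ ℚ.+-monoʳ-≤ q (p≤∣p∣ (p ℚ.- q)) ⟩
    q ℚ.+ ∣ p ℚ.- q ∣   <⟨ ℚ.+-monoʳ-< q lt ⟩
    q ℚ.+ ε             ∎
    where
    open ℚ.≤-Reasoning
    p≤∣p∣ : ∀ r → r ℚ.≤ ∣ r ∣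
    p≤∣p∣ r with ℚ.≤-total 0ℚ r
    ... | inj₁ 0≤r = ℚ.≤-reflexive (sym (ℚ.0≤p⇒∣p∣≡p 0≤r))
    ... | inj₂ r≤0 = ℚ.≤-trans r≤0 (ℚ.0≤∣p∣ r)

  -- The rationals as real numbers.
  const : ℚ → ℝ
  const q = mkℝ (λ _ → q) λ ε 0<ε →
    0 , λ _ _ _ _ → subst (λ z → ∣ z ∣ ℚ.< ε) (sym (ℚ.+-inverseʳ q)) 0<ε

  const-mono-≤ : ∀ {p q} → p ℚ.≤ q → const p ≤ const q
  const-mono-≤ {p} {q} p≤q ε 0<ε = 0 , λ _ _ → ℚ.≤-trans p≤q (p≤p+ε q 0<ε)

  const-mono-< : ∀ {p q} → p ℚ.< q → const p < const q
  const-mono-< {p} {q} p<q = q ℚ.- p ,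
    subst (ℚ._< q ℚ.- p) (ℚ.+-inverseʳ p) (ℚ.+-monoˡ-< (ℚ.- p) p<q) ,
    0 , λ _ _ → ℚ.≤-reflexive (cancel-sub p q)

  <-irreflℝ : ∀ x → ¬ x < x
  <-irreflℝ x (ε , 0<ε , N , h) = <⇒≱ℚ (p<p+ε (seq x N) 0<ε) (h N ℕ.≤-refl)

  <-≤-transℝ : ∀ x y z → x < y → y ≤ z → x < z
  <-≤-transℝ x y z (ε , 0<ε , N , h) y≤z with half 0<ε
  ... | (d , 0<d , d+d≡ε) with y≤z d 0<d
  ... | (M , k) = d , 0<d , N ℕ.⊔ M , λ n le → ≤-cancelʳ d (begin
    seq x n ℚ.+ d ℚ.+ d     ≡⟨ trans (ℚ.+-assoc (seq x n) d d) (cong (seq x n ℚ.+_) d+d≡ε) ⟩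
    seq x n ℚ.+ ε           ≤⟨ h n (ℕ.m⊔n≤o⇒m≤o N M le) ⟩
    seq y n                 ≤⟨ k n (ℕ.m⊔n≤o⇒n≤o N M le) ⟩
    seq z n ℚ.+ d           ∎)
    where open ℚ.≤-Reasoning

  ≤-<-transℝ : ∀ x y z → x ≤ y → y < z → x < z
  ≤-<-transℝ x y z x≤y (ε , 0<ε , N , h) with half 0<ε
  ... | (d , 0<d , d+d≡ε) with x≤y d 0<d
  ... | (M , k) = d , 0<d , N ℕ.⊔ M , λ n le → begin
    seq x n ℚ.+ d           ≤⟨ ℚ.+-monoˡ-≤ d (k n (ℕ.m⊔n≤o⇒n≤o N M le)) ⟩
    seq y n ℚ.+ d ℚ.+ d     ≡⟨ trans (ℚ.+-assoc (seq y n) d d) (cong (seq y n ℚ.+_) d+d≡ε) ⟩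
    seq y n ℚ.+ ε           ≤⟨ h n (ℕ.m⊔n≤o⇒m≤o N M le) ⟩
    seq z n                 ∎
    where open ℚ.≤-Reasoning

  <⇒≤ℝ : ∀ x y → x < y → x ≤ y
  <⇒≤ℝ x y (ε , 0<ε , N , h) δ 0<δ = N , λ n le →
    ℚ.≤-trans (p≤p+ε (seq x n) 0<ε) (ℚ.≤-trans (h n le) (p≤p+ε (seq y n) 0<δ))

  ≤-reflℝ : ∀ x → x ≤ x
  ≤-reflℝ x ε 0<ε = 0 , λ n _ → p≤p+ε (seq x n) 0<ε

  ≤-transℝ : ∀ x y z → x ≤ y → y ≤ z → x ≤ z
  ≤-transℝ x y z x≤y y≤z ε 0<ε with half 0<ε
  ... | (d , 0<d , d+d≡ε) with x≤y d 0<d | y≤z d 0<d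
  ... | (M , h) | (N , k) = M ℕ.⊔ N , λ n le → begin
    seq x n                 ≤⟨ h n (ℕ.m⊔n≤o⇒m≤o M N le) ⟩
    seq y n ℚ.+ d           ≤⟨ ℚ.+-monoˡ-≤ d (k n (ℕ.m⊔n≤o⇒n≤o M N le)) ⟩
    seq z n ℚ.+ d ℚ.+ d     ≡⟨ trans (ℚ.+-assoc (seq z n) d d) (cong (seq z n ℚ.+_) d+d≡ε) ⟩
    seq z n ℚ.+ ε           ∎
    where open ℚ.≤-Reasoning

  +-mono-≤ℝ : ∀ x x′ y y′ → x ≤ x′ → y ≤ y′ → x + y ≤ x′ + y′
  +-mono-≤ℝ x x′ y y′ x≤x′ y≤y′ ε 0<ε with half 0<ε
  ... | (d , 0<d , d+d≡ε) with x≤x′ d 0<d | y≤y′ d 0<d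
  ... | (M , h) | (N , k) = M ℕ.⊔ N , λ n le → begin
    seq x n ℚ.+ seq y n
      ≤⟨ ℚ.+-mono-≤ (h n (ℕ.m⊔n≤o⇒m≤o M N le)) (k n (ℕ.m⊔n≤o⇒n≤o M N le)) ⟩
    (seq x′ n ℚ.+ d) ℚ.+ (seq y′ n ℚ.+ d)
      ≡⟨ solve 3 (λ a b e → (a :+ e) :+ (b :+ e) := (a :+ b) :+ (e :+ e)) refl
           (seq x′ n) (seq y′ n) d ⟩
    (seq x′ n ℚ.+ seq y′ n) ℚ.+ (d ℚ.+ d)
      ≡⟨ cong (seq x′ n ℚ.+ seq y′ n ℚ.+_) d+d≡ε ⟩
    (seq x′ n ℚ.+ seq y′ n) ℚ.+ ε ∎
    where
    open ℚ.≤-Reasoning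
    open +-*-Solver

  four-below-five : ∀ a b d {ε c} → a ℚ.< b ℚ.+ d → d ℚ.+ d ℚ.+ d ℚ.+ d ℚ.+ d ≡ ε →
    b ℚ.+ ε ℚ.≤ c → a ℚ.+ d ℚ.+ d ℚ.+ d ℚ.+ d ℚ.≤ c
  four-below-five a b d {ε} {c} lt 5d≡ε le = begin
    a ℚ.+ d ℚ.+ d ℚ.+ d ℚ.+ d
      ≤⟨ ℚ.+-monoˡ-≤ d (ℚ.+-monoˡ-≤ d (ℚ.+-monoˡ-≤ d (ℚ.+-monoˡ-≤ d (ℚ.<⇒≤ lt)))) ⟩
    b ℚ.+ d ℚ.+ d ℚ.+ d ℚ.+ d ℚ.+ d
      ≡⟨ solve 2 (λ x e → x :+ e :+ e :+ e :+ e :+ e := x :+ (e :+ e :+ e :+ e :+ e)) refl b d ⟩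
    b ℚ.+ (d ℚ.+ d ℚ.+ d ℚ.+ d ℚ.+ d)
      ≡⟨ cong (b ℚ.+_) 5d≡ε ⟩
    b ℚ.+ ε
      ≤⟨ le ⟩
    c ∎
    where
    open ℚ.≤-Reasoning
    open +-*-Solver

  opaque
    -- A rational interval inside a real interval.
    rational-subinterval : ∀ x y → x < y →
      Σ[ p ∈ ℚ ] Σ[ q ∈ ℚ ] p ℚ.< q × x < const p × const q < y
    rational-subinterval x y (ε , 0<ε , N , h) with fifth 0<ε
    ... | (d , 0<d , 5d≡ε) with cauchy x d 0<d
    ... | (M , c) = p , q , p<p+ε p 0<d , (d , 0<d , K , x<p) , (d , 0<d , K , q<y)
      where
      K : ℕ
      K = N ℕ.⊔ M
      xK p q : ℚ
      xK = seq x K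
      p = xK ℚ.+ d ℚ.+ d
      q = p ℚ.+ d

      x<p : ∀ n → K ℕ.≤ n → seq x n ℚ.+ d ℚ.≤ xK ℚ.+ d ℚ.+ d
      x<p n K≤n = ℚ.+-monoˡ-≤ d (ℚ.<⇒≤ (∣p-q∣<ε⇒p<q+ε {seq x n} {xK} {d}
        (c n K (ℕ.≤-trans (ℕ.m≤n⊔m N M) K≤n) (ℕ.m≤n⊔m N M))))

      q<y : ∀ n → K ℕ.≤ n → xK ℚ.+ d ℚ.+ d ℚ.+ d ℚ.+ d ℚ.≤ seq y n
      q<y n K≤n = four-below-five xK (seq x n) d (∣p-q∣<ε⇒p<q+ε {xK} {seq x n} {d}
        (c K n (ℕ.m≤n⊔m N M) (ℕ.≤-trans (ℕ.m≤n⊔m N M) K≤n))) 5d≡ε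
        (h n (ℕ.≤-trans (ℕ.m≤m⊔n N M) K≤n))

  -- Coding sequences of natural numbers by real numbers

  opaque
    ℚ×ℚ↣ℕ : (ℚ × ℚ) ↣ ℕ
    ℚ×ℚ↣ℕ = ℕ×ℕ↣ℕ ↣-∘ ×-↣ ℚ↣ℕ ℚ↣ℕ

    -- The j-th nondegenerate interval with rational endpoints.
    interval : ℕ → Σ[ p ∈ ℚ ] Σ[ q ∈ ℚ ] p ℚ.< q
    interval j with decode (0ℚ , 1ℚ) ℚ×ℚ↣ℕ j
    ... | (p , q) with p ℚ.<? q
    ... | yes p<q = p , q , p<q
    ... | no _    = 0ℚ , 1ℚ , ℚ.positive⁻¹ 1ℚ

    interval-surjective : ∀ {p q} (p<q : p ℚ.< q) →
      Σ[ j ∈ ℕ ] proj₁ (interval j) ≡ p × proj₁ (proj₂ (interval j)) ≡ q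
    interval-surjective {p} {q} p<q = j , ends
      where
      j : ℕ
      j = Injection.to ℚ×ℚ↣ℕ (p , q)
      ends : proj₁ (interval j) ≡ p × proj₁ (proj₂ (interval j)) ≡ q
      ends with decode (0ℚ , 1ℚ) ℚ×ℚ↣ℕ j | decode-to (0ℚ , 1ℚ) ℚ×ℚ↣ℕ (p , q)
      ... | _ | refl with p ℚ.<? q
      ... | yes _  = refl , refl
      ... | no p≮q = ⊥-elim (p≮q p<q)

    -- A strictly increasing sequence of rationals in the j-th interval, with the
    -- proof that each of them is below the right endpoint.
    cuts : ∀ j → ℕ → Σ[ c ∈ ℚ ] c ℚ.< proj₁ (proj₂ (interval j))
    cuts j zero    = proj₁ (interval j) , proj₂ (proj₂ (interval j))
    cuts j (suc v) = let (m , _ , m<q) = ℚ.<-dense (proj₂ (cuts j v)) in m , m<q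

    cut : ℕ → ℕ → ℚ
    cut j v = proj₁ (cuts j v)

    cut-< : ∀ j v → cut j v ℚ.< cut j (suc v)
    cut-< j v = proj₁ (proj₂ (ℚ.<-dense (proj₂ (cuts j v))))

    cut-mono : ∀ j {v w} → v ℕ.≤ w → cut j v ℚ.≤ cut j w
    cut-mono j {v} {w} v≤w = go (ℕ.≤⇒≤′ v≤w)
      where
      go : ∀ {w} → v ℕ.≤′ w → cut j v ℚ.≤ cut j w
      go ℕ.≤′-refl = ℚ.≤-refl
      go (ℕ.≤′-step {n = w} le) = ℚ.≤-trans (go le) (ℚ.<⇒≤ (cut-< j w))

    cut-<-interval : ∀ j v → cut j v ℚ.< proj₁ (proj₂ (interval j))
    cut-<-interval j v = proj₂ (cuts j v)

    interval-≤-cut : ∀ j v → proj₁ (interval j) ℚ.≤ cut j v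
    interval-≤-cut j v = cut-mono j {0} {v} ℕ.z≤n

  -- Every rational interval contains all the cuts with some index j.
  cuts-inside : ∀ {p q} → p ℚ.< q →
    Σ[ j ∈ ℕ ] ∀ v → p ℚ.≤ cut j v × cut j v ℚ.< q
  cuts-inside {p} {q} p<q with interval-surjective p<q
  ... | (j , eq , eq′) = j , λ v →
    subst (ℚ._≤ cut j v) eq (interval-≤-cut j v) , subst (cut j v ℚ.<_) eq′ (cut-<-interval j v)

  -- For each j the cells with index v are disjoint open subintervals of the j-th
  -- interval; the real r codes the sequence whose j-th term is the index of the
  -- cell containing r, if there is one.
  InCell : ℝ → ℕ → ℕ → Set
  InCell r j v = const (cut j v) < r × r < const (cut j (suc v))

  cells-disjoint : ∀ r j v w → v ℕ.< w → InCell r j v → ¬ InCell r j w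
  cells-disjoint r j v w v<w (_ , r<c) (c<r , _) =
    <-irreflℝ r (<-≤-transℝ r (const (cut j (suc v))) r r<c
      (≤-transℝ (const (cut j (suc v))) (const (cut j w)) r
        (const-mono-≤ {cut j (suc v)} {cut j w} (cut-mono j {suc v} {w} v<w))
        (<⇒≤ℝ (const (cut j w)) r c<r)))

  cell-unique : ∀ r j v w → InCell r j v → InCell r j w → v ≡ w
  cell-unique r j v w p q with ℕ.<-cmp v w
  ... | tri≈ _ v≡w _ = v≡w
  ... | tri< v<w _ _ = ⊥-elim (cells-disjoint r j v w v<w p q)
  ... | tri> _ _ w<v = ⊥-elim (cells-disjoint r j w v w<v q p)

  -- Every real interval meets all cells with some index j.
  cells-inside : ∀ a b → a < b →
    Σ[ j ∈ ℕ ] ∀ v → Σ[ x ∈ ℝ ] a < x × x < b × InCell x j v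
  cells-inside a b a<b with rational-subinterval a b a<b
  ... | (p , q , p<q , a<p , q<b) with cuts-inside p<q
  ... | (j , inside) = j , λ v → point v (ℚ.<-dense (cut-< j v))
    where
    point : ∀ v → (Σ[ m ∈ ℚ ] cut j v ℚ.< m × m ℚ.< cut j (suc v)) →
      Σ[ x ∈ ℝ ] a < x × x < b × InCell x j v
    point v (m , c<m , m<c′) = const m ,
      <-≤-transℝ a (const p) (const m) a<p
        (const-mono-≤ (ℚ.≤-trans (proj₁ (inside v)) (ℚ.<⇒≤ c<m))) ,
      ≤-<-transℝ (const m) (const q) b
        (const-mono-≤ (ℚ.<⇒≤ (ℚ.<-trans m<c′ (proj₂ (inside (suc v)))))) q<b ,
      const-mono-< {cut j v} {m} c<m , const-mono-< {m} {cut j (suc v)} m<c′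

  -- The reals that lie, for every j, outside the cell with indices j and φ j.
  Avoids : (ℕ → ℕ) → 𝒫 ℝ
  Avoids φ r = ∀ j → ¬ InCell r j (φ j)

  -- In the cell with index φ j there is no point of Avoids φ.
  avoids-nowhere-dense : ∀ φ → NowhereDense (Avoids φ)
  avoids-nowhere-dense φ a b a<b dense =
    let (j , cell)               = cells-inside a b a<b
        (m , a<m , m<b , c , c′) = cell (φ j)
        (y , avoids , in-cell)   =
          dense m a<m m<b (const (cut j (φ j))) (const (cut j (suc (φ j)))) c c′
    in avoids j in-cell

  avoids-meager : ∀ φ → Meager (Avoids φ)
  avoids-meager φ =
    (λ {x} {y} (x≤y , y≤x) avoids j (c<y , y<c′) →
      avoids j
        ( <-≤-transℝ (const (cut j (φ j))) y x c<y y≤x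
        , ≤-<-transℝ x y (const (cut j (suc (φ j)))) x≤y y<c′)) ,
    (λ _ → Avoids φ) , (λ _ → avoids-nowhere-dense φ) , (λ r → 0 , r) , λ (_ , r) → r

  -- The covering number

  meager-resp-≐ : ∀ {S T : 𝒫 ℝ} → S ≐ T → Meager S → Meager T
  meager-resp-≐ (S⊆T , T⊆S) (resp , N , nd , S⊆⋃ , ⋃⊆S) =
    (λ x≃y x∈T → S⊆T (resp x≃y (T⊆S x∈T))) ,
    N , nd , (λ x∈T → S⊆⋃ (T⊆S x∈T)) , λ x∈⋃ → S⊆T (⋃⊆S x∈⋃)

  -- A covering family of meager sets may be indexed with repetitions: an index
  -- set without repetitions is given by canonical indices of its members.
  cov-≤-index : ∀ {κ ν} → cov-ℳ κ → (e : ν → 𝒫 ℝ) → (∀ i → Meager (e i)) →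
    (∀ x → Σ[ i ∈ ν ] x ∈ e i) → κ ↣ ν
  cov-≤-index {κ} {ν} (_ , minimum) e meager covers =
    mk↣ {to = proj₁} canonical-≡ ↣-∘ minimum Canonical
      ( (λ S → Σ[ i ∈ ν ] e i ≐ S)
      , ( (λ (i , _) → e i)
        , (λ (i , _) → i , (λ p → p) , (λ p → p))
        , (λ (i , ri≡i) (j , rj≡j) ei≐ej →
             canonical-≡ (trans (sym ri≡i) (trans (rep-cong ei≐ej) rj≡j)))
        , (λ { S (i , ei≐S) → (rep i , rep-cong (rep-≐ i)) ,
               (λ p → proj₁ ei≐S (proj₁ (rep-≐ i) p)) , λ p → proj₂ (rep-≐ i) (proj₂ ei≐S p) }))
      , (λ { S (i , ei≐S) → meager-resp-≐ ei≐S (meager i) })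
      , (λ x → let (i , x∈ei) = covers x in e i , (i , (λ p → p) , (λ p → p)) , x∈ei))
    where
    class : ν → ν → Bool
    class i j = ⟦ e j ≐ e i ⟧

    pick : (ν → Bool) → ν → ν
    pick P i with em {P = Σ[ j ∈ ν ] P j ≡ true}
    ... | yes (j , _) = j
    ... | no _        = i

    pick-true : ∀ (P : ν → Bool) {i} k → P i ≡ true → P (pick P k) ≡ true
    pick-true P k Pi with em {P = Σ[ j ∈ ν ] P j ≡ true}
    ... | yes (_ , Pj) = Pj
    ... | no none      = ⊥-elim (none (_ , Pi))

    pick-cong : ∀ (P : ν → Bool) {i} k k′ → P i ≡ true → pick P k ≡ pick P k′
    pick-cong P k k′ Pi with em {P = Σ[ j ∈ ν ] P j ≡ true}
    ... | yes _   = refl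
    ... | no none = ⊥-elim (none (_ , Pi))

    rep : ν → ν
    rep i = pick (class i) i

    class-refl : ∀ i → class i i ≡ true
    class-refl i = ⟦⟧-true ((λ p → p) , (λ p → p))

    rep-≐ : ∀ i → e (rep i) ≐ e i
    rep-≐ i = true-⟦⟧ (pick-true (class i) i (class-refl i))

    class-cong : ∀ {i j} → e i ≐ e j → class i ≡ class j
    class-cong (f , g) = fe λ k → bool-ext
      (λ t → let (u , v) = true-⟦⟧ t in ⟦⟧-true ((λ p → f (u p)) , λ p → v (g p)))
      (λ t → let (u , v) = true-⟦⟧ t in ⟦⟧-true ((λ p → g (u p)) , λ p → v (f p)))

    rep-cong : ∀ {i j} → e i ≐ e j → rep i ≡ rep j
    rep-cong {i} {j} ei≐ej = trans (cong (λ c → pick c i) (class-cong ei≐ej))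
      (pick-cong (class j) i j (class-refl j))

    Canonical : Set
    Canonical = Σ[ i ∈ ν ] rep i ≡ i

    canonical-≡ : {c c′ : Canonical} → proj₁ c ≡ proj₁ c′ → c ≡ c′
    canonical-≡ {_ , u} {_ , v} refl = cong (_ ,_) (uip u v)

  -- Fewer than cov(ℳ) many sequences are all met by one sequence.
  cov-≤-or-guessing : ∀ {κ ν} → cov-ℳ κ → (Φ : ν → ℕ → ℕ) →
    (κ ↣ ν) ⊎ (Σ[ x ∈ (ℕ → ℕ) ] ∀ i → Σ[ j ∈ ℕ ] x j ≡ Φ i j)
  cov-≤-or-guessing {κ} {ν} cov Φ with em {P = ∀ r → Σ[ i ∈ ν ] r ∈ Avoids (Φ i)}
  ... | yes covers = inj₁ (cov-≤-index cov (Avoids ∘ Φ) (avoids-meager ∘ Φ) covers)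
  ... | no ¬covers with ¬∀⇒∃¬ ¬covers
  ... | (r , uncovered) = inj₂ (x , λ i →
      let (j , p) = ¬∀¬⇒∃ (λ avoids → uncovered (i , avoids)) in j , x-cell j p)
    where
    x : ℕ → ℕ
    x j with em {P = Σ[ v ∈ ℕ ] InCell r j v}
    ... | yes (v , _) = v
    ... | no _        = 0

    x-cell : ∀ j {v} → InCell r j v → x j ≡ v
    x-cell j p with em {P = Σ[ v ∈ ℕ ] InCell r j v}
    ... | yes (_ , p′) = cell-unique r j _ _ p′ p
    ... | no none      = ⊥-elim (none (_ , p))

  -- No sequence meets all sequences of zeros and ones.
  cov-≤-𝔠 : ∀ {κ} → cov-ℳ κ → κ ↣ 𝔠
  cov-≤-𝔠 cov with cov-≤-or-guessing cov (λ α j → if α j then 1 else 0)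
  ... | inj₁ i = i
  ... | inj₂ (x , guess) with guess (λ j → ⌊ x j ℕ.≟ 0 ⌋)
  ... | (j , eq) with x j
  ... | zero  = case eq of λ ()
  ... | suc _ = case eq of λ ()

  -- Finite sets of natural numbers

  -- A strict upper bound of the members.
  bound : List ℕ → ℕ
  bound = foldr (λ m b → suc m ℕ.⊔ b) 0

  <-bound : ∀ {xs m} → m List.∈ xs → m ℕ.< bound xs
  <-bound {x ∷ xs} (here refl) = ℕ.m≤m⊔n (suc x) (bound xs)
  <-bound {x ∷ xs} (there m∈)  = ℕ.≤-trans (<-bound m∈) (ℕ.m≤n⊔m (suc x) (bound xs))

  fresh : ∀ {S} → ¬ IsFinite S → ∀ xs → Σ[ m ∈ ℕ ] S m × ¬ m List.∈ xs
  fresh inf xs = ¬∀¬⇒∃ λ none → inf (xs , λ {m} m∈S → dne λ m∉xs → none m (m∈S , m∉xs))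

  infinite-list : ∀ {S} → ¬ IsFinite S → ∀ n →
    Σ[ xs ∈ List ℕ ] Unique xs × All S xs × length xs ≡ n
  infinite-list inf zero    = [] , [] , [] , refl
  infinite-list inf (suc n) with infinite-list inf n
  ... | (xs , u , a , refl) with fresh inf xs
  ... | (m , m∈S , m∉xs) = m ∷ xs ,
    All.tabulate (λ { x∈xs refl → m∉xs x∈xs }) ∷ u , m∈S ∷ a , refl

  -- Rational weights

  opaque
    -- Powers of ½.
    pow½ : ℕ → ℚ
    pow½ zero    = 1ℚ
    pow½ (suc n) = pow½ n ℚ.* ½

    pow½-0 : pow½ 0 ≡ 1ℚ
    pow½-0 = refl

    pow½-double : ∀ n → pow½ (suc n) ℚ.+ pow½ (suc n) ≡ pow½ n
    pow½-double n = trans (sym (ℚ.*-distribˡ-+ (pow½ n) ½ ½)) (ℚ.*-identityʳ (pow½ n))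

    pow½-positive : ∀ n → 0ℚ ℚ.< pow½ n
    pow½-positive zero    = ℚ.positive⁻¹ 1ℚ
    pow½-positive (suc n) =
      subst (ℚ._< pow½ n ℚ.* ½) (ℚ.*-zeroˡ ½) (ℚ.*-monoˡ-<-pos ½ (pow½-positive n))

  pow½-≤-suc : ∀ n → pow½ (suc n) ℚ.≤ pow½ n
  pow½-≤-suc n = subst (pow½ (suc n) ℚ.≤_) (pow½-double n)
    (p≤p+ε (pow½ (suc n)) (pow½-positive (suc n)))

  pow½-anti : ∀ {m n} → m ℕ.≤ n → pow½ n ℚ.≤ pow½ m
  pow½-anti {m} {n} m≤n = go n (ℕ.≤⇒≤′ m≤n)
    where
    go : ∀ n → m ℕ.≤′ n → pow½ n ℚ.≤ pow½ m
    go n ℕ.≤′-refl = ℚ.≤-refl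
    go (suc n) (ℕ.≤′-step le) = ℚ.≤-trans (pow½-≤-suc n) (go n le)

  2^n·pow½ : ∀ n → (2 ℕ.^ n) · pow½ n ≡ 1ℚ
  2^n·pow½ zero = trans (ℚ.+-identityʳ (pow½ 0)) pow½-0
  2^n·pow½ (suc n) = begin
    (2 ℕ.^ n ℕ.+ (2 ℕ.^ n ℕ.+ 0)) · pow½ (suc n)
      ≡⟨ cong (λ k → (2 ℕ.^ n ℕ.+ k) · pow½ (suc n)) (ℕ.+-identityʳ (2 ℕ.^ n)) ⟩
    (2 ℕ.^ n ℕ.+ 2 ℕ.^ n) · pow½ (suc n)
      ≡⟨ Mult.×-homo-+ (pow½ (suc n)) (2 ℕ.^ n) (2 ℕ.^ n) ⟩
    (2 ℕ.^ n) · pow½ (suc n) ℚ.+ (2 ℕ.^ n) · pow½ (suc n)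
      ≡⟨ Mult.×-distrib-+ (pow½ (suc n)) (pow½ (suc n)) (2 ℕ.^ n) ⟨
    (2 ℕ.^ n) · (pow½ (suc n) ℚ.+ pow½ (suc n))
      ≡⟨ cong ((2 ℕ.^ n) ·_) (pow½-double n) ⟩
    (2 ℕ.^ n) · pow½ n
      ≡⟨ 2^n·pow½ n ⟩
    1ℚ ∎
    where open ≡-Reasoning

  opaque
    toℚᵘ-· : ∀ n → ℚ.toℚᵘ (n · 1ℚ) ℚᵘ.≃ mkℚᵘ (ℤ.+ n) 0
    toℚᵘ-· zero    = ℚᵘ.*≡* refl
    toℚᵘ-· (suc n) = ℚᵘ.≃-trans (ℚ.toℚᵘ-homo-+ 1ℚ (n · 1ℚ))
      (ℚᵘ.≃-trans (ℚᵘ.+-congʳ (ℚ.toℚᵘ 1ℚ) (toℚᵘ-· n))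
        (ℚᵘ.*≡* (cong (λ k → (ℤ.+ 1 ℤ.+ k) ℤ.* ℤ.+ 1) (ℤ.*-identityʳ (ℤ.+ n)))))

    archimedean : ∀ q → Σ[ n ∈ ℕ ] q ℚ.≤ n · 1ℚ
    archimedean q@(mkℚ i d _) = ℤ.∣ i ∣ , ℚ.toℚᵘ-cancel-≤ (ℚᵘ.≤-respʳ-≃ (ℚᵘ.≃-sym (toℚᵘ-· ℤ.∣ i ∣))
      (ℚᵘ.*≤* (i*1≤ i d)))
      where
      i*1≤ : ∀ i d → i ℤ.* ℤ.+ 1 ℤ.≤ ℤ.+ ℤ.∣ i ∣ ℤ.* ℤ.+ suc d
      i*1≤ (ℤ.+ n) d = ℤ.≤-trans (ℤ.≤-reflexive (ℤ.*-identityʳ (ℤ.+ n)))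
        (subst (ℤ.+ n ℤ.≤_) (ℤ.pos-* n (suc d)) (ℤ.+≤+ (ℕ.m≤m*n n (suc d))))
      i*1≤ ℤ.-[1+ n ] d = ℤ.-≤+

  -- Sums of rational weights.
  wsum : (ℕ → ℚ) → List ℕ → ℚ
  wsum w = foldr (λ m s → w m ℚ.+ s) 0ℚ

  wsum-++ : ∀ w xs ys → wsum w (xs ++ ys) ≡ wsum w xs ℚ.+ wsum w ys
  wsum-++ w [] ys = sym (ℚ.+-identityˡ (wsum w ys))
  wsum-++ w (x ∷ xs) ys = trans (cong (w x ℚ.+_) (wsum-++ w xs ys))
    (sym (ℚ.+-assoc (w x) (wsum w xs) (wsum w ys)))

  wsum-remove : ∀ w ps x qs → wsum w (ps ++ x ∷ qs) ≡ w x ℚ.+ wsum w (ps ++ qs)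
  wsum-remove w [] x qs = refl
  wsum-remove w (p ∷ ps) x qs = begin
    w p ℚ.+ wsum w (ps ++ x ∷ qs)          ≡⟨ cong (w p ℚ.+_) (wsum-remove w ps x qs) ⟩
    w p ℚ.+ (w x ℚ.+ wsum w (ps ++ qs))    ≡⟨ ℚ.+-assoc (w p) (w x) _ ⟨
    (w p ℚ.+ w x) ℚ.+ wsum w (ps ++ qs)    ≡⟨ cong (ℚ._+ wsum w (ps ++ qs)) (ℚ.+-comm (w p) (w x)) ⟩
    (w x ℚ.+ w p) ℚ.+ wsum w (ps ++ qs)    ≡⟨ ℚ.+-assoc (w x) (w p) _ ⟩
    w x ℚ.+ (w p ℚ.+ wsum w (ps ++ qs))    ∎
    where open ≡-Reasoning

  wsum-nonneg : ∀ w → (∀ m → 0ℚ ℚ.≤ w m) → ∀ xs → 0ℚ ℚ.≤ wsum w xs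
  wsum-nonneg w 0≤w []       = ℚ.≤-refl
  wsum-nonneg w 0≤w (x ∷ xs) = ℚ.+-mono-≤ (0≤w x) (wsum-nonneg w 0≤w xs)

  wsum-⊆ : ∀ w → (∀ m → 0ℚ ℚ.≤ w m) → ∀ xs ys → Unique xs →
    (∀ m → m List.∈ xs → m List.∈ ys) → wsum w xs ℚ.≤ wsum w ys
  wsum-⊆ w 0≤w [] ys _ _ = wsum-nonneg w 0≤w ys
  wsum-⊆ w 0≤w (x ∷ xs) ys (x∉ ∷ u) sub with List.∈-∃++ (sub x (here refl))
  ... | (ps , qs , refl) = subst (wsum w (x ∷ xs) ℚ.≤_) (sym (wsum-remove w ps x qs))
    (ℚ.+-monoʳ-≤ (w x) (wsum-⊆ w 0≤w xs (ps ++ qs) u sub′))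
    where
    sub′ : ∀ m → m List.∈ xs → m List.∈ ps ++ qs
    sub′ m m∈ with List.∈-++⁻ ps (sub m (there m∈))
    ... | inj₁ m∈ps = List.∈-++⁺ˡ m∈ps
    ... | inj₂ (here refl) = ⊥-elim (All.lookup x∉ m∈ refl)
    ... | inj₂ (there m∈qs) = List.∈-++⁺ʳ ps m∈qs

  wsum-≥ : ∀ w q xs → All (λ m → q ℚ.≤ w m) xs → length xs · q ℚ.≤ wsum w xs
  wsum-≥ w q [] [] = ℚ.≤-refl
  wsum-≥ w q (x ∷ xs) (le ∷ a) = ℚ.+-mono-≤ le (wsum-≥ w q xs a)

  sum-≤-wsum : ∀ g w xs → All (λ m → g m ≤ const (w m)) xs → sum g xs ≤ const (wsum w xs)
  sum-≤-wsum g w [] [] = ≤-reflℝ 0ℝ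
  sum-≤-wsum g w (x ∷ xs) (le ∷ a) =
    +-mono-≤ℝ (g x) (const (w x)) (sum g xs) (const (wsum w xs)) le (sum-≤-wsum g w xs a)

  wsum-≤-sum : ∀ g w xs → All (λ m → const (w m) ≤ g m) xs → const (wsum w xs) ≤ sum g xs
  wsum-≤-sum g w [] [] = ≤-reflℝ 0ℝ
  wsum-≤-sum g w (x ∷ xs) (le ∷ a) =
    +-mono-≤ℝ (const (w x)) (g x) (const (wsum w xs)) (sum g xs) le (wsum-≤-sum g w xs a)

  -- Summability

  -- A real number is bounded by a rational number, eventually along its sequence.
  bounded-by : ∀ x → Σ[ q ∈ ℚ ] Σ[ K ∈ ℕ ] ∀ n → K ℕ.≤ n → seq x n ℚ.< q
  bounded-by x =
    let (K , close) = cauchy x 1ℚ (ℚ.positive⁻¹ 1ℚ) in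
    seq x K ℚ.+ 1ℚ , K , λ n K≤n → ∣p-q∣<ε⇒p<q+ε {seq x n} {seq x K} (close n K K≤n ℕ.≤-refl)

  const-≤⇒≤ : ∀ p x q K → (∀ n → K ℕ.≤ n → seq x n ℚ.< q) → const p ≤ x → p ℚ.≤ q ℚ.+ 1ℚ
  const-≤⇒≤ p x q K x<q p≤x =
    let (N , h) = p≤x 1ℚ (ℚ.positive⁻¹ 1ℚ) in
    ℚ.≤-trans (h (K ℕ.⊔ N) (ℕ.m≤n⊔m K N)) (ℚ.+-monoˡ-≤ 1ℚ (ℚ.<⇒≤ (x<q (K ℕ.⊔ N) (ℕ.m≤m⊔n K N))))

  unbounded⇒∉Summable : ∀ g B →
    (∀ n → Σ[ xs ∈ List ℕ ] Unique xs × All B xs × const (n · 1ℚ) ≤ sum g xs) → B ∉ Summable g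
  unbounded⇒∉Summable g B large (M , bounded) =
    let (q , K , M<q)     = bounded-by M
        (n , big)         = archimedean (q ℚ.+ 1ℚ ℚ.+ 1ℚ)
        (xs , u , a , le) = large n
    in <⇒≱ℚ (p<p+ε (q ℚ.+ 1ℚ) (ℚ.positive⁻¹ 1ℚ)) (ℚ.≤-trans big
         (const-≤⇒≤ (n · 1ℚ) M q K M<q
           (≤-transℝ (const (n · 1ℚ)) (sum g xs) M le (bounded xs u a))))

  ≰⇒≥ℝ : ∀ x q → ¬ x ≤ const q → const q ≤ x
  ≰⇒≥ℝ x q x≰q δ 0<δ with ¬∀⇒∃¬ x≰q
  ... | (ε , p) with ¬→⇒×¬ p
  ... | (0<ε , p′) with cauchy x ε 0<ε
  ... | (N , close) with ¬∀⇒∃¬ (λ h → p′ (N , h))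
  ... | (n , p″) with ¬→⇒×¬ p″
  ... | (N≤n , xn≰) = N , λ m N≤m → ℚ.≤-trans
    (≤-cancelʳ ε (ℚ.<⇒≤ (ℚ.<-trans (ℚ.≰⇒> xn≰)
      (∣p-q∣<ε⇒p<q+ε {seq x n} {seq x m} (close n m N≤n N≤m)))))
    (p≤p+ε (seq x m) 0<δ)

  -- The weights of a tall summable ideal converge to 0.
  tall⇒null : ∀ g → Tall (Summable g) → ∀ k → IsFinite (λ m → ¬ g m ≤ const (pow½ k))
  tall⇒null g tall k = dne λ infinite →
    let (T , T⊆S , T-infinite , summable) = tall _ infinite in
    unbounded⇒∉Summable g T (large T T⊆S T-infinite) summable
    where
    large : ∀ T → T ⊆ (λ m → ¬ g m ≤ const (pow½ k)) → ¬ IsFinite T → ∀ n →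
      Σ[ xs ∈ List ℕ ] Unique xs × All T xs × const (n · 1ℚ) ≤ sum g xs
    large T T⊆S inf n =
      let (xs , u , a , len) = infinite-list inf (n ℕ.* 2 ℕ.^ k) in xs , u , a ,
      ≤-transℝ (const (n · 1ℚ)) (const (wsum (λ _ → pow½ k) xs)) (sum g xs)
        (const-mono-≤ (ℚ.≤-trans (ℚ.≤-reflexive (n≡ xs len))
          (wsum-≥ (λ _ → pow½ k) (pow½ k) xs (All.universal (λ _ → ℚ.≤-refl) xs))))
        (wsum-≤-sum g (λ _ → pow½ k) xs (All.map (λ {m} m∈T → ≰⇒≥ℝ (g m) (pow½ k) (T⊆S m∈T)) a))
      where
      n≡ : ∀ xs → length xs ≡ n ℕ.* 2 ℕ.^ k → n · 1ℚ ≡ length xs · pow½ k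
      n≡ xs len = trans (cong (n ·_) (sym (2^n·pow½ k)))
        (trans (Mult.×-assocˡ (pow½ k) n (2 ℕ.^ k)) (cong (_· pow½ k) (sym len)))

  -- A level function for g bounds g by powers of ½. At level 0 there is no bound,
  -- which admits finitely many large values of g.
  IsLevel : (ℕ → ℝ) → (ℕ → ℕ) → Set
  IsLevel g ℓ = ∀ m → 1 ℕ.≤ ℓ m → g m ≤ const (pow½ (ℓ m))

  FiniteToOne : (ℕ → ℕ) → Set
  FiniteToOne ℓ = ∀ j → IsFinite (λ m → ℓ m ℕ.< j)

  -- The largest positive k ≤ n with P k, or 0.
  greatest : (ℕ → Set) → ℕ → ℕ
  greatest P zero = 0
  greatest P (suc n) with em {P = P (suc n)}
  ... | yes _ = suc n
  ... | no _  = greatest P n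

  greatest-holds : ∀ P n → 1 ℕ.≤ greatest P n → P (greatest P n)
  greatest-holds P (suc n) le with em {P = P (suc n)}
  ... | yes p = p
  ... | no _  = greatest-holds P n le

  ≤-greatest : ∀ P n k → k ℕ.≤ n → P k → k ℕ.≤ greatest P n
  ≤-greatest P zero    k k≤n p = k≤n
  ≤-greatest P (suc n) k k≤n p with em {P = P (suc n)}
  ... | yes _ = k≤n
  ... | no ¬p with ℕ.m≤n⇒m<n∨m≡n k≤n
  ... | inj₁ (ℕ.s≤s k≤n′) = ≤-greatest P n k k≤n′ p
  ... | inj₂ refl = ⊥-elim (¬p p)

  -- The level of m is the largest positive k ≤ m with g m ≤ 2⁻ᵏ, or 0; the restriction
  -- to k ≤ m takes care of vanishing weights.
  tall⇒level : ∀ g → Tall (Summable g) → Σ[ ℓ ∈ (ℕ → ℕ) ] IsLevel g ℓ × FiniteToOne ℓ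
  tall⇒level g tall = (λ m → greatest (Below m) m) , (λ m → greatest-holds (Below m) m) , λ j →
    let (xs , below) = tall⇒null g tall j in
    upTo j ++ xs , λ {m} lt → dne λ m∉ →
      ℕ.<⇒≱ lt (≤-greatest (Below m) m j
        (ℕ.≮⇒≥ λ m<j → m∉ (List.∈-++⁺ˡ (List.∈-upTo⁺ m<j)))
        (dne λ h → m∉ (List.∈-++⁺ʳ (upTo j) (below h))))
    where
    Below : ℕ → ℕ → Set
    Below m k = g m ≤ const (pow½ k)

  -- A finite set s is thin at j if its members have level at least card s + j. Then
  -- it has weight at most card s · 2⁻ᶜᵃʳᵈ⁽ˢ⁾⁻ʲ ≤ 2⁻ʲ.
  Thin : (ℕ → ℕ) → ℕ → FinSet → Set
  Thin ℓ j s = ∀ m → m List.∈ s → card s ℕ.+ j ℕ.≤ ℓ m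

  block-weight : ∀ (ℓ : ℕ → ℕ) j ys → (∀ m → m List.∈ ys → length ys ℕ.+ j ℕ.≤ ℓ m) →
    wsum (λ m → pow½ (ℓ m)) ys ℚ.≤ pow½ j
  block-weight ℓ j [] _ = ℚ.<⇒≤ (pow½-positive j)
  block-weight ℓ j (y ∷ ys) h = subst (wsum (λ m → pow½ (ℓ m)) (y ∷ ys) ℚ.≤_) (pow½-double j)
    (ℚ.+-mono-≤ (pow½-anti (ℕ.≤-trans (ℕ.s≤s (ℕ.m≤n+m j (length ys))) (h y (here refl))))
      (block-weight ℓ (suc j) ys λ m m∈ →
        subst (ℕ._≤ ℓ m) (sym (ℕ.+-suc (length ys) j)) (h m (there m∈))))

  module _ (g : ℕ → ℝ) (ℓ : ℕ → ℕ) (level : IsLevel g ℓ)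
           (s : ℕ → FinSet) (thin : ∀ j → Thin ℓ j (s j)) where

    private
      w : ℕ → ℚ
      w m = pow½ (ℓ m)

      block : ℕ → List ℕ
      block j = deduplicate ℕ._≟_ (s j)

      -- The n sets from s a on.
      blocks : ℕ → ℕ → List ℕ
      blocks a zero    = []
      blocks a (suc n) = block a ++ blocks (suc a) n

      ∈-blocks : ∀ a n i {m} → i ℕ.< n → m List.∈ s (a ℕ.+ i) → m List.∈ blocks a n
      ∈-blocks a (suc n) zero {m} lt m∈ = List.∈-++⁺ˡ
        (List.∈-deduplicate⁺ ℕ._≟_ (subst (λ j → m List.∈ s j) (ℕ.+-identityʳ a) m∈))
      ∈-blocks a (suc n) (suc i) {m} (ℕ.s≤s lt) m∈ = List.∈-++⁺ʳ (block a)
        (∈-blocks (suc a) n i lt (subst (λ j → m List.∈ s j) (ℕ.+-suc a i) m∈))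

      blocks-weight : ∀ a n → wsum w (blocks a n) ℚ.≤ pow½ a ℚ.+ pow½ a
      blocks-weight a zero = ℚ.+-mono-≤ (ℚ.<⇒≤ (pow½-positive a)) (ℚ.<⇒≤ (pow½-positive a))
      blocks-weight a (suc n) = begin
        wsum w (block a ++ blocks (suc a) n)
          ≡⟨ wsum-++ w (block a) (blocks (suc a) n) ⟩
        wsum w (block a) ℚ.+ wsum w (blocks (suc a) n)
          ≤⟨ ℚ.+-mono-≤
               (block-weight ℓ a (block a) λ m m∈ → thin a m (List.∈-deduplicate⁻ ℕ._≟_ (s a) m∈))
               (blocks-weight (suc a) n) ⟩
        pow½ a ℚ.+ (pow½ (suc a) ℚ.+ pow½ (suc a))
          ≡⟨ cong (pow½ a ℚ.+_) (pow½-double a) ⟩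
        pow½ a ℚ.+ pow½ a ∎
        where open ℚ.≤-Reasoning

      finitely-many-blocks : ∀ xs → All (λ m → Σ[ j ∈ ℕ ] m List.∈ s j) xs →
        Σ[ n ∈ ℕ ] All (λ m → Σ[ j ∈ ℕ ] j ℕ.< n × m List.∈ s j) xs
      finitely-many-blocks [] [] = 0 , []
      finitely-many-blocks (x ∷ xs) ((j , x∈) ∷ a) with finitely-many-blocks xs a
      ... | (n , b) = suc j ℕ.⊔ n , (j , ℕ.m≤m⊔n (suc j) n , x∈) ∷
        All.map (λ (i , i<n , m∈) → i , ℕ.≤-trans i<n (ℕ.m≤n⊔m (suc j) n) , m∈) b

      level-≥1 : ∀ {m} → (Σ[ j ∈ ℕ ] m List.∈ s j) → 1 ℕ.≤ ℓ m
      level-≥1 {m} (j , m∈) = ℕ.≤-trans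
        (ℕ.≤-trans (nonempty (List.∈-deduplicate⁺ ℕ._≟_ m∈)) (ℕ.m≤m+n (card (s j)) j)) (thin j m m∈)
        where
        nonempty : ∀ {x : ℕ} {xs} → x List.∈ xs → 1 ℕ.≤ length xs
        nonempty (here _)  = ℕ.s≤s ℕ.z≤n
        nonempty (there _) = ℕ.s≤s ℕ.z≤n

    -- A thin union has weight at most Σ 2⁻ʲ = 2.
    thin⇒summable : ∀ B → B ⊆ (λ m → Σ[ j ∈ ℕ ] m List.∈ s j) → B ∈ Summable g
    thin⇒summable B B⊆ = const (pow½ 0 ℚ.+ pow½ 0) , λ xs u a →
      let (n , b) = finitely-many-blocks xs (All.map B⊆ a) in
      ≤-transℝ (sum g xs) (const (wsum w xs)) (const (pow½ 0 ℚ.+ pow½ 0))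
        (sum-≤-wsum g w xs (All.map (λ {m} m∈B → level m (level-≥1 (B⊆ m∈B))) a))
        (const-mono-≤ (ℚ.≤-trans
          (wsum-⊆ w (λ m → ℚ.<⇒≤ (pow½-positive (ℓ m))) xs (blocks 0 n) u
            λ m m∈ → let (j , j<n , m∈s) = All.lookup b m∈ in ∈-blocks 0 n j j<n m∈s)
          (blocks-weight 0 n)))

  -- An infinite set contains points of S at levels 1, 2, …; singletons of such
  -- points are thin.
  level⇒tall : ∀ g ℓ → IsLevel g ℓ → FiniteToOne ℓ → Tall (Summable g)
  level⇒tall g ℓ level fto S S-infinite =
    (λ m → Σ[ j ∈ ℕ ] m ≡ point j) ,
    (λ { (j , refl) → proj₁ (proj₂ (chosen j)) }) ,
    (λ (xs , all) → let j = bound xs in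
      proj₂ (proj₂ (chosen j)) (List.∈-++⁺ˡ (List.∈-upTo⁺ (<-bound (all (j , refl)))))) ,
    thin⇒summable g ℓ level (λ j → [ point j ]) thin _ (λ { (j , refl) → j , here refl })
    where
    chosen : ∀ j → Σ[ m ∈ ℕ ] S m × ¬ m List.∈ upTo j ++ proj₁ (fto (suc j))
    chosen j = fresh S-infinite (upTo j ++ proj₁ (fto (suc j)))

    point : ℕ → ℕ
    point j = proj₁ (chosen j)

    thin : ∀ j → Thin ℓ j [ point j ]
    thin j _ (here refl) = ℕ.≮⇒≥ λ lt →
      proj₂ (proj₂ (chosen j)) (List.∈-++⁺ʳ (upTo j) (proj₂ (fto (suc j)) lt))

  -- Sets guessed against the strategies of Player I

  ∅-ideal : ∀ {𝒥} → IsIdeal 𝒥 → ∀ {S} → (∀ n → ¬ S n) → S ∈ 𝒥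
  ∅-ideal ideal none = IsIdeal.finite ideal ([] , λ {n} n∈S → ⊥-elim (none n n∈S))

  ∈⇒∈↾ : ∀ {𝒥 : Family ℕ} {A S : 𝒫 ℕ} → S ⊆ A → S ∈ 𝒥 → S ∈ 𝒥 ↾ A
  ∈⇒∈↾ {S = S} S⊆A S∈𝒥 = S , S∈𝒥 , (λ p → p , S⊆A p) , proj₁

  ∈↾⇒∈ : ∀ {𝒥 : Family ℕ} → IsIdeal 𝒥 → ∀ {A S : 𝒫 ℕ} → S ∈ 𝒥 ↾ A → S ∈ 𝒥
  ∈↾⇒∈ ideal (B , B∈𝒥 , S⊆ , _) = IsIdeal.⊆-closed ideal (λ p → proj₁ (S⊆ p)) B∈𝒥

  -- A sequence that meets μ-many sequences somewhere, when μ < cov(ℳ) and the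
  -- sequences are indexed by finite sequences of indices and countable data.
  guessing : ∀ {κ μ} → cov-ℳ κ → ¬ (κ ↣ μ) → (Φ : List μ × List FinSet → ℕ → ℕ) →
    Σ[ x ∈ (ℕ → ℕ) ] ∀ i → Σ[ j ∈ ℕ ] x j ≡ Φ i j
  guessing {κ} {μ} cov small Φ = by-size (↣-total ℕ μ)
    where
    histories : List FinSet ↣ ℕ
    histories = List-↣ℕ (List-↣ℕ id-↣)

    by-size : (ℕ ↣ μ) ⊎ (μ ↣ ℕ) → Σ[ x ∈ (ℕ → ℕ) ] ∀ i → Σ[ j ∈ ℕ ] x j ≡ Φ i j
    by-size (inj₁ ι) =
      Sum.[ (λ i → ⊥-elim (small (index ↣-∘ i))) , (λ x → x) ] (cov-≤-or-guessing cov Φ)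
      where
      index : (List μ × List FinSet) ↣ μ
      index = X×X↣X ι ↣-∘ ×-↣ (List-↣-infinite ι) (ι ↣-∘ histories)
    by-size (inj₂ c) = (λ n → Φ (decode ([] , []) index n) n) ,
      λ i → Injection.to index i ,
        cong (λ i′ → Φ i′ (Injection.to index i)) (decode-to ([] , []) index i)
      where
      index : (List μ × List FinSet) ↣ ℕ
      index = ℕ×ℕ↣ℕ ↣-∘ ×-↣ (List-↣ℕ c) histories

  -- The bound for the size of the next response after Player II played t.
  allowance : StrategyI → List FinSet → ℕ
  allowance σ []      = StrategyI.k₀ σ
  allowance σ (G ∷ t) = proj₂ (StrategyI.respond σ (G ∷ t))

  allowance-k : ∀ σ G n → allowance σ (applyUpTo G n) ≡ Play.k σ G n
  allowance-k σ G zero    = refl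
  allowance-k σ G (suc n) = refl

  -- A strategy of Player I such that for every play f⁻¹[⋃ Fₙ] ∩ A is positive.
  WinsOn : Family ℕ → 𝒫 ℕ → (ℕ → ℕ) → Set
  WinsOn 𝒥 A f = Σ[ σ ∈ StrategyI ] ∀ G → let open Play σ G in
    Legal × (A ∩ (f ⊢ ⋃F)) ∉ 𝒥

  -- A sequence x codes the union B x of thin finite sets. If x guesses, after every
  -- history, the response of a winning strategy to some move of Player II that makes
  -- this response thin, then Player II can play such that all responses lie in B x.
  module Generic (ℓ : ℕ → ℕ) (fto : FiniteToOne ℓ) where

    FinSet↣ℕ : FinSet ↣ ℕ
    FinSet↣ℕ = List-↣ℕ id-↣

    -- The move of Player II that makes the response thin at index j.
    move : StrategyI → List FinSet → ℕ → FinSet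
    move σ t j = proj₁ (fto (allowance σ t ℕ.+ j))

    -- The code of the response to this move.
    target : StrategyI → List FinSet → ℕ → ℕ
    target σ t j = Injection.to FinSet↣ℕ (proj₁ (StrategyI.respond σ (t ∷ʳ move σ t j)))

    module _ (x : ℕ → ℕ) where

      -- The j-th set coded by x, provided that it is thin.
      s : ℕ → FinSet
      s j with em {P = Thin ℓ j (decode [] FinSet↣ℕ (x j))}
      ... | yes _ = decode [] FinSet↣ℕ (x j)
      ... | no _  = []

      s-thin : ∀ j → Thin ℓ j (s j)
      s-thin j with em {P = Thin ℓ j (decode [] FinSet↣ℕ (x j))}
      ... | yes thin = thin
      ... | no _     = λ m ()

      s-≡ : ∀ j F → x j ≡ Injection.to FinSet↣ℕ F → Thin ℓ j F → s j ≡ F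
      s-≡ j F eq thin with em {P = Thin ℓ j (decode [] FinSet↣ℕ (x j))}
      ... | yes _ = trans (cong (decode [] FinSet↣ℕ) eq) (decode-to [] FinSet↣ℕ F)
      ... | no ¬thin = ⊥-elim (¬thin (subst (Thin ℓ j)
              (sym (trans (cong (decode [] FinSet↣ℕ) eq) (decode-to [] FinSet↣ℕ F))) thin))

      -- The set coded by x.
      B : 𝒫 ℕ
      B m = Σ[ j ∈ ℕ ] m List.∈ s j

      B-positive : ∀ 𝒥 → IsIdeal 𝒥 → ∀ A f → ((σ , _) : WinsOn 𝒥 A f) →
        (∀ t → Σ[ j ∈ ℕ ] x j ≡ target σ t j) → (A ∩ (f ⊢ B)) ∉ 𝒥
      B-positive 𝒥 ideal A f (σ , wins) guess A∩B∈𝒥 =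
        proj₂ (wins G) (IsIdeal.⊆-closed ideal
          (λ (n∈A , n , m∈F) → n∈A , index (history n) ,
            subst (λ F → _ List.∈ F) (sym (s-response n)) m∈F) A∩B∈𝒥)
        where
        index : List FinSet → ℕ
        index t = proj₁ (guess t)

        history : ℕ → List FinSet
        history zero    = []
        history (suc n) = history n ∷ʳ move σ (history n) (index (history n))

        G : ℕ → FinSet
        G n = move σ (history n) (index (history n))

        open Play σ G

        history-≡ : ∀ n → applyUpTo G n ≡ history n
        history-≡ zero    = refl
        history-≡ (suc n) = trans (sym (List.applyUpTo-∷ʳ G n)) (cong (_∷ʳ G n) (history-≡ n))

        response-thin : ∀ n → Thin ℓ (index (history n)) (F n)
        response-thin n m m∈F = ℕ.≮⇒≥ λ lt → proj₁ (proj₁ (wins G) n) m m∈F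
          (proj₂ (fto (allowance σ (history n) ℕ.+ index (history n)))
            (ℕ.≤-trans lt (ℕ.+-monoˡ-≤ (index (history n)) (ℕ.≤-trans (proj₂ (proj₁ (wins G) n))
              (ℕ.≤-reflexive (trans (sym (allowance-k σ G n))
                (cong (allowance σ) (history-≡ n))))))))

        s-response : ∀ n → s (index (history n)) ≡ F n
        s-response n = s-≡ (index (history n)) (F n)
          (trans (proj₂ (guess (history n)))
            (cong (λ t → Injection.to FinSet↣ℕ (proj₁ (StrategyI.respond σ t)))
              (sym (history-≡ (suc n)))))
          (response-thin n)

  -- A family 𝒜 of cardinality μ with the 𝒥⁺-FIP, and a function f.
  module _ (ℐ 𝒥 : Family ℕ) (ideal-ℐ : IsIdeal ℐ) (ideal-𝒥 : IsIdeal 𝒥)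
           (tall-summable : ContainsTallSummable ℐ) (wins : PlayerIWinsAll 𝒥)
           {μ : Set} (𝒜 : Family ℕ) (card-𝒜 : HasCardinality 𝒜 μ) (fip-𝒜 : HasFIP 𝒥 𝒜)
           (f : ℕ → ℕ) where

    private
      e : μ → 𝒫 ℕ
      e = proj₁ card-𝒜

      -- The finite intersections of 𝒜.
      A : List μ → 𝒫 ℕ
      A L = ⋂ᶠ (map e L)

      A-positive : ∀ L → A L ∉ 𝒥
      A-positive L = HasFIP.fip fip-𝒜 (map e L)
        (All.map⁺ (All.universal (proj₁ (proj₂ card-𝒜)) L))

      A-++ : ∀ L L′ → A (L ++ L′) ⊆ A L ∩ A L′
      A-++ []      L′ p = tt , p
      A-++ (i ∷ L) L′ (p , q) = let (r , s) = A-++ L L′ q in (p , r) , s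

    fip-with : ∀ B → (∀ L → (A L ∩ (f ⊢ B)) ∉ 𝒥) → HasFIP 𝒥 (𝒜 ∪ (_≐ (f ⊢ B)))
    fip-with B positive = record
      { nonempty = let (S , S∈𝒜) = HasFIP.nonempty fip-𝒜 in S , inj₁ S∈𝒜
      ; fip      = λ F all ⋂F∈𝒥 → let (L , sub) = refine F all in
                     positive L (IsIdeal.⊆-closed ideal-𝒥 sub ⋂F∈𝒥)
      }
      where
      refine : ∀ F → All (𝒜 ∪ (_≐ (f ⊢ B))) F → Σ[ L ∈ List μ ] A L ∩ (f ⊢ B) ⊆ ⋂ᶠ F
      refine [] [] = [] , λ _ → tt
      refine (S ∷ F) (inj₁ S∈𝒜 ∷ all) =
        let (L , sub) = refine F all
            (i , ei⊆S , _) = proj₂ (proj₂ (proj₂ card-𝒜)) S S∈𝒜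
        in i ∷ L , λ ((p , q) , b) → ei⊆S p , sub (q , b)
      refine (S ∷ F) (inj₂ (_ , f⊢B⊆S) ∷ all) =
        let (L , sub) = refine F all in L , λ (q , b) → f⊢B⊆S b , sub (q , b)

    -- If finitely many values of f suffice modulo 𝒥 on some A L, then these values
    -- already form the required member of ℐ.
    finite-case : ∀ L K → (A L ∩ (λ n → ¬ f n List.∈ K)) ∈ 𝒥 →
      Σ[ B ∈ 𝒫 ℕ ] B ∈ ℐ × HasFIP 𝒥 (𝒜 ∪ (_≐ (f ⊢ B)))
    finite-case L K small = (List._∈ K) , IsIdeal.finite ideal-ℐ (K , λ p → p) ,
      fip-with (List._∈ K) λ L′ small′ → A-positive (L ++ L′)
        (IsIdeal.⊆-closed ideal-𝒥 {T = (A L ∩ (λ n → ¬ f n List.∈ K)) ∪ (A L′ ∩ (f ⊢ (List._∈ K)))}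
          (λ {n} p → let (q , q′) = A-++ L L′ p in case em {P = f n List.∈ K} of λ
            { (yes in-K) → inj₂ (q′ , in-K)
            ; (no ∉K)    → inj₁ (q , ∉K) })
          (IsIdeal.∪-closed ideal-𝒥 small small′))

    module _ (large : ∀ L K → (A L ∩ (λ n → ¬ f n List.∈ K)) ∉ 𝒥) where

      -- If only the fibers over K are positive on A L, then f is 𝒥-to-one off them.
      finitely-many-fibers : ∀ L K → (∀ {n} → (A L ∩ (f ⊢ ｛ n ｝)) ∉ 𝒥 → n List.∈ K) →
        WinsOn 𝒥 (A L) f
      finitely-many-fibers L K in-K =
        let (σ , win) = wins A′ (large L K) f′ to-one in
        σ , λ G → proj₁ (win G) , λ small → proj₂ (win G) (∈⇒∈↾ proj₁
          (IsIdeal.⊆-closed ideal-𝒥 (λ ((p , _) , q) → p , q) small))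
        where
        A′ : 𝒫 ℕ
        A′ = A L ∩ (λ n → ¬ f n List.∈ K)

        f′ : A′ ⟶ω
        f′ n _ = f n

        in-fiber : ∀ n → Dec (n List.∈ K) → preimage f′ ｛ n ｝ ∈ 𝒥
        in-fiber n (yes n∈K) = ∅-ideal ideal-𝒥 λ m ((_ , fm∉K) , n≡fm) →
          fm∉K (subst (List._∈ K) n≡fm n∈K)
        in-fiber n (no n∉K)  = IsIdeal.⊆-closed ideal-𝒥 (λ ((p , _) , q) → p , q)
          (dne λ positive → n∉K (in-K positive))

        to-one : (𝒥 -to-one) f′
        to-one n = in-fiber n em

      -- Otherwise Player I plays values with positive fibers.
      infinitely-many-fibers : ∀ L → ¬ IsFinite (λ n → (A L ∩ (f ⊢ ｛ n ｝)) ∉ 𝒥) →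
        WinsOn 𝒥 (A L) f
      infinitely-many-fibers L infinite = σ , λ G → legal G ,
        λ small → proj₁ (proj₂ (chosen (applyUpTo G 1)))
          (IsIdeal.⊆-closed ideal-𝒥 (λ (p , n≡fm) → p , 0 , here (sym n≡fm)) small)
        where
        chosen : ∀ t → Σ[ n ∈ ℕ ] (A L ∩ (f ⊢ ｛ n ｝)) ∉ 𝒥 × ¬ n List.∈ concat t
        chosen t = fresh infinite (concat t)

        σ : StrategyI
        σ = record { k₀ = 1 ; respond = λ t → [ proj₁ (chosen t) ] , 1 }

        k≡1 : ∀ G n → Play.k σ G n ≡ 1
        k≡1 G zero    = refl
        k≡1 G (suc n) = refl

        legal : ∀ G → Play.Legal σ G
        legal G n =
          (λ { m (here refl) m∈G → proj₂ (proj₂ (chosen (applyUpTo G (suc n))))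
                 (List.∈-concat⁺′ m∈G (List.∈-applyUpTo⁺ G (ℕ.n<1+n n))) }) ,
          ℕ.≤-reflexive (sym (k≡1 G n))

      wins-on : ∀ L → WinsOn 𝒥 (A L) f
      wins-on L = by-fibers em
        where
        by-fibers : Dec (IsFinite (λ n → (A L ∩ (f ⊢ ｛ n ｝)) ∉ 𝒥)) → WinsOn 𝒥 (A L) f
        by-fibers (yes (K , in-K)) = finitely-many-fibers L K in-K
        by-fibers (no infinite)    = infinitely-many-fibers L infinite

      -- The set B coded by a guessing sequence belongs to ℐ, and f⁻¹[B] meets every A L
      -- in a positive set.
      infinite-case : ∀ {κ} → cov-ℳ κ → ¬ (κ ↣ μ) →
        Σ[ B ∈ 𝒫 ℕ ] B ∈ ℐ × HasFIP 𝒥 (𝒜 ∪ (_≐ (f ⊢ B)))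
      infinite-case cov small =
        let (g , _ , tall , ⊆ℐ)   = tall-summable
            (ℓ , level , fto)     = tall⇒level g tall
            module Gen            = Generic ℓ fto
            (x , guess)           = guessing cov small λ (L , t) → Gen.target (proj₁ (wins-on L)) t
        in Gen.B x ,
           ⊆ℐ (thin⇒summable g ℓ level (Gen.s x) (Gen.s-thin x) (Gen.B x) (λ p → p)) ,
           fip-with (Gen.B x) λ L →
             Gen.B-positive x 𝒥 ideal-𝒥 (A L) f (wins-on L) λ t → guess (L , t)

  cov-≤-fip : ∀ ℐ 𝒥 → IsIdeal ℐ → IsIdeal 𝒥 → ContainsTallSummable ℐ → PlayerIWinsAll 𝒥 →
    cov-ℳ ≤ᶜ 𝔣𝔦𝔭 ℐ 𝒥 U
  cov-≤-fip ℐ 𝒥 _ _ _ _ κ μ cov (inj₁ ((𝔠↣μ , _) , _) , _) = 𝔠↣μ ↣-∘ cov-≤-𝔠 cov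
  cov-≤-fip ℐ 𝒥 ideal-ℐ ideal-𝒥 ts wins κ μ cov (inj₂ (𝒜 , card-𝒜 , fip-𝒜 , fails) , _) =
    dne λ small → fails λ f _ → extend f small em
    where
    -- Modulo 𝒥, finitely many values of f suffice on some finite intersection.
    Almost-finite : (ℕ → ℕ) → Set
    Almost-finite f = Σ[ L ∈ List μ ] Σ[ K ∈ List ℕ ]
      (⋂ᶠ (map (proj₁ card-𝒜) L) ∩ (λ n → ¬ f n List.∈ K)) ∈ 𝒥

    extend : ∀ f → ¬ (κ ↣ μ) → Dec (Almost-finite f) →
      Σ[ B ∈ 𝒫 ℕ ] B ∈ ℐ × HasFIP 𝒥 (𝒜 ∪ (_≐ (f ⊢ B)))
    extend f small (yes (L , K , p)) =
      finite-case ℐ 𝒥 ideal-ℐ ideal-𝒥 ts wins 𝒜 card-𝒜 fip-𝒜 f L K p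
    extend f small (no none) = infinite-case ℐ 𝒥 ideal-ℐ ideal-𝒥 ts wins 𝒜 card-𝒜 fip-𝒜 f
      (λ L K p → none (L , K , p)) cov small

  -- Borel sets are analytic

  -- Agreement below N.
  Agree : ℕ → 𝒫 ℕ → 𝒫 ℕ → Set
  Agree N S T = ∀ n → n ℕ.< N → n ∈ S ⇔ n ∈ T

  AgreeSeq : ℕ → (ℕ → ℕ) → (ℕ → ℕ) → Set
  AgreeSeq N y y′ = ∀ n → n ℕ.< N → y n ≡ y′ n

  agree-sym : ∀ {N S T} → Agree N S T → Agree N T S
  agree-sym a n lt = mk⇔ (Equivalence.from (a n lt)) (Equivalence.to (a n lt))

  agree-trans : ∀ {N S T V} → Agree N S T → Agree N T V → Agree N S V
  agree-trans a b n lt = mk⇔ (Equivalence.to (b n lt) ∘ Equivalence.to (a n lt))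
    (Equivalence.from (a n lt) ∘ Equivalence.from (b n lt))

  agree-≤ : ∀ {M N S T} → M ℕ.≤ N → Agree N S T → Agree M S T
  agree-≤ le a n lt = a n (ℕ.≤-trans lt le)

  -- Closed subsets of P(ω) × ω^ω: exclusion is secured by finite initial segments.
  Closed : (𝒫 ℕ → (ℕ → ℕ) → Set₁) → Set₁
  Closed C = ∀ S y → ¬ C S y →
    Σ[ N ∈ ℕ ] ∀ S′ y′ → Agree N S S′ → AgreeSeq N y y′ → ¬ C S′ y′

  -- Analytic sets are the projections of closed sets.
  record Analytic (𝒰 : Family ℕ) : Set₂ where
    field
      relation : 𝒫 ℕ → (ℕ → ℕ) → Set₁
      closed   : Closed relation
      witness  : ∀ S → S ∈ 𝒰 → Σ[ y ∈ (ℕ → ℕ) ] relation S y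
      sound    : ∀ S y → relation S y → S ∈ 𝒰
  open Analytic

  analytic-resp-≐ : ∀ {𝒰 𝒱} → 𝒰 ≐ 𝒱 → Analytic 𝒰 → Analytic 𝒱
  analytic-resp-≐ (to , from) a = record
    { relation = relation a
    ; closed   = closed a
    ; witness  = λ S S∈𝒱 → witness a S (from S∈𝒱)
    ; sound    = λ S y r → to (sound a S y r)
    }

  -- The first term of the witness is the length of a securing initial segment.
  open⇒analytic : ∀ {𝒰} → IsOpen 𝒰 → Analytic 𝒰
  open⇒analytic {𝒰} is-open = record
    { relation = λ S y → ∀ T → Agree (y 0) S T → T ∈ 𝒰
    ; closed   = λ S y ¬r → suc (y 0) , λ S′ y′ a b r′ → ¬r λ T c →
        r′ T (subst (λ N → Agree N S′ T) (b 0 (ℕ.s≤s ℕ.z≤n))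
          (agree-trans {V = T} (agree-sym {S = S} (agree-≤ {S = S} {S′} (ℕ.n≤1+n (y 0)) a)) c))
    ; witness  = λ S S∈𝒰 → let (N , h) = is-open S S∈𝒰 in (λ _ → N) , h
    ; sound    = λ S y r → r S λ n _ → mk⇔ (λ p → p) (λ p → p)
    }

  closed⇒analytic : ∀ {𝒰} → IsOpen 𝒰 → Analytic (∁ 𝒰)
  closed⇒analytic {𝒰} is-open = record
    { relation = λ S _ → Lift _ (S ∉ 𝒰)
    ; closed   = λ S y ¬r → let (N , h) = is-open S (dne λ S∉𝒰 → ¬r (lift S∉𝒰)) in
        N , λ S′ y′ a b r′ → lower r′ (h S′ a)
    ; witness  = λ S S∉𝒰 → (λ _ → 0) , lift S∉𝒰
    ; sound    = λ S y → lower
    }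

  -- The first term of the witness selects a member of the union.
  ⋃-analytic : ∀ {𝒰 : ℕ → Family ℕ} → (∀ n → Analytic (𝒰 n)) → Analytic (⋃ ℕ 𝒰)
  ⋃-analytic a = record
    { relation = λ S y → relation (a (y 0)) S (y ∘ suc)
    ; closed   = λ S y ¬r → let (N , h) = closed (a (y 0)) S (y ∘ suc) ¬r in
        suc N , λ S′ y′ b c r′ → h S′ (y′ ∘ suc) (agree-≤ {S = S} {S′} (ℕ.n≤1+n N) b)
          (λ n lt → c (suc n) (ℕ.s≤s lt))
          (subst (λ i → relation (a i) S′ (y′ ∘ suc)) (sym (c 0 (ℕ.s≤s ℕ.z≤n))) r′)
    ; witness  = λ S (n , S∈𝒰ₙ) → let (y , r) = witness (a n) S S∈𝒰ₙ in
        (λ { zero → n ; (suc m) → y m }) , r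
    ; sound    = λ S y r → y 0 , sound (a (y 0)) S (y ∘ suc) r
    }

  pair-monoʳ : ∀ n {k l} → k ℕ.≤ l → pair n k ℕ.≤ pair n l
  pair-monoʳ n k≤l = ℕ.+-monoˡ-≤ n (ℕ.*-mono-≤ (ℕ.+-monoʳ-≤ n k≤l) (ℕ.+-monoʳ-≤ n k≤l))

  -- A sequence of sequences as one sequence.
  merge : (ℕ → ℕ → ℕ) → ℕ → ℕ
  merge y m = let (n , k) = decode (0 , 0) ℕ×ℕ↣ℕ m in y n k

  row : (ℕ → ℕ) → ℕ → ℕ → ℕ
  row y n k = y (pair n k)

  row-merge : ∀ y n → row (merge y) n ≡ y n
  row-merge y n = fe λ k → cong (λ (i , j) → y i j) (decode-to (0 , 0) ℕ×ℕ↣ℕ (n , k))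

  agree-row : ∀ n N {y y′} → AgreeSeq (suc (pair n N)) y y′ → AgreeSeq N (row y n) (row y′ n)
  agree-row n N a k lt = a (pair n k) (ℕ.s≤s (pair-monoʳ n (ℕ.<⇒≤ lt)))

  agreeSeq-≤ : ∀ {M N y y′} → M ℕ.≤ N → AgreeSeq N y y′ → AgreeSeq M y y′
  agreeSeq-≤ le a n lt = a n (ℕ.≤-trans lt le)

  -- The rows of the witness are witnesses for the members of the intersection.
  ⋂-analytic : ∀ {𝒰 : ℕ → Family ℕ} → (∀ n → Analytic (∁ (𝒰 n))) → Analytic (∁ (⋃ ℕ 𝒰))
  ⋂-analytic a = record
    { relation = λ S y → ∀ n → relation (a n) S (row y n)
    ; closed   = λ S y ¬r →
        let (n , ¬rₙ) = ¬∀⇒∃¬ ¬r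
            (N , h)   = closed (a n) S (row y n) ¬rₙ
        in N ℕ.+ suc (pair n N) , λ S′ y′ b c r′ →
          h S′ (row y′ n) (agree-≤ {S = S} {S′} (ℕ.m≤m+n N _) b)
            (agree-row n N (agreeSeq-≤ {y = y} {y′} (ℕ.m≤n+m _ N) c)) (r′ n)
    ; witness  = λ S S∉⋃ →
        let y = λ n → witness (a n) S (λ S∈𝒰ₙ → S∉⋃ (n , S∈𝒰ₙ)) in
        merge (λ n → proj₁ (y n)) ,
        λ n → subst (relation (a n) S) (sym (row-merge (λ n → proj₁ (y n)) n)) (proj₂ (y n))
    ; sound    = λ S y r (n , S∈𝒰ₙ) → sound (a n) S (row y n) (r n) S∈𝒰ₙ
    }

  borel⇒analytic : ∀ {𝒰} → IsBorel 𝒰 → Analytic 𝒰 × Analytic (∁ 𝒰)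
  borel⇒analytic (open-set o)   = open⇒analytic o , closed⇒analytic o
  borel⇒analytic (complement b) = let (a , a′) = borel⇒analytic b in
    a′ , analytic-resp-≐ ((λ p ¬p → ¬p p) , dne) a
  borel⇒analytic (union b)      =
    ⋃-analytic (λ n → proj₁ (borel⇒analytic (b n))) ,
    ⋂-analytic (λ n → proj₂ (borel⇒analytic (b n)))
  borel⇒analytic (resp-≐ (to , from) b) = let (a , a′) = borel⇒analytic b in
    analytic-resp-≐ (to , from) a , analytic-resp-≐ ((λ p q → p (from q)) , λ p q → p (to q)) a′

  -- For an ideal, the closed relation may be taken downward closed in the first
  -- argument: a witness for S names a superset of S together with a witness for it.
  Monotone : (𝒫 ℕ → (ℕ → ℕ) → Set₁) → Set₁
  Monotone C = ∀ S S′ y → S′ ⊆ S → C S y → C S′ y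

  -- The set named by the row 0 of w.
  named : (ℕ → ℕ) → 𝒫 ℕ
  named w n = row w 0 n ≡ 1

  analytic-ideal : ∀ {𝒥} → IsIdeal 𝒥 → Analytic 𝒥 → Σ[ a ∈ Analytic 𝒥 ] Monotone (relation a)
  analytic-ideal {𝒥} ideal a = record
    { relation = λ S w → S ⊆ named w × relation a (named w) (row w 1)
    ; closed   = λ S w ¬r → separate S w ¬r em
    ; witness  = λ S S∈𝒥 → let (y , r) = witness a S S∈𝒥 in
        merge (rows S y) ,
        (λ {n} n∈S → trans (cong (λ z → z n) (row-merge (rows S y) 0)) (char-∈ S n n∈S)) ,
        -- the named set is S up to extensional equality only
        dne λ ¬r → let (N , h) = closed a _ _ ¬r in
          h S y (λ n _ → mk⇔
              (λ eq → char-true S n (trans (sym (cong (λ z → z n) (row-merge (rows S y) 0))) eq))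
              (λ n∈S → trans (cong (λ z → z n) (row-merge (rows S y) 0)) (char-∈ S n n∈S)))
            (λ n _ → cong (λ z → z n) (row-merge (rows S y) 1)) r
    ; sound    = λ S w (S⊆ , r) → IsIdeal.⊆-closed ideal S⊆ (sound a _ _ r)
    } , λ S S′ w S′⊆S (S⊆ , r) → (λ p → S⊆ (S′⊆S p)) , r
    where
    char : 𝒫 ℕ → ℕ → ℕ
    char S n = if ⟦ S n ⟧ then 1 else 0

    char-∈ : ∀ S n → n ∈ S → char S n ≡ 1
    char-∈ S n n∈S = cong (λ b → if b then 1 else 0) (⟦⟧-true n∈S)

    char-true : ∀ S n → char S n ≡ 1 → n ∈ S
    char-true S n eq = true-⟦⟧ (bit eq)
      where
      bit : ∀ {b} → (if b then 1 else 0) ≡ 1 → b ≡ true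
      bit {true} _ = refl

    rows : 𝒫 ℕ → (ℕ → ℕ) → ℕ → ℕ → ℕ
    rows S y zero    = char S
    rows S y (suc _) = y

    R : 𝒫 ℕ → (ℕ → ℕ) → Set₁
    R S w = S ⊆ named w × relation a (named w) (row w 1)

    separate : ∀ S w → ¬ R S w → Dec (S ⊆ named w) →
      Σ[ N ∈ ℕ ] ∀ S′ w′ → Agree N S S′ → AgreeSeq N w w′ → ¬ R S′ w′
    separate S w ¬r (no S⊈) =
      let (n , h)     = ¬∀⇒∃¬ {P = λ n → n ∈ S → n ∈ named w} (λ k → S⊈ (λ {n} → k n))
          (n∈S , n∉w) = ¬→⇒×¬ h
      in suc n ℕ.+ suc (pair 0 n) , λ S′ w′ b c (S′⊆ , _) →
        n∉w (trans (c (pair 0 n) (ℕ.m≤n+m _ (suc n)))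
          (S′⊆ (Equivalence.to (b n (ℕ.m≤m+n (suc n) _)) n∈S)))
    separate S w ¬r (yes S⊆) =
      let (N , h) = closed a _ _ (λ r → ¬r (S⊆ , r)) in
      suc (pair 0 N) ℕ.+ suc (pair 1 N) , λ S′ w′ b c (_ , r′) →
        h (named w′) (row w′ 1)
          (λ n lt →
            let c′ = agreeSeq-≤ {y = w} {w′} (ℕ.m≤m+n (suc (pair 0 N)) _) c
                eq = agree-row 0 N c′ n lt in
            mk⇔ (λ p → trans (sym eq) p) (λ p → trans eq p))
          (agree-row 1 N (agreeSeq-≤ {y = w} {w′} (ℕ.m≤n+m _ (suc (pair 0 N))) c)) r′

  -- Cardinality of finite sets

  unique-⊆⇒length-≤ : ∀ {xs ys : List ℕ} → Unique xs → (∀ m → m List.∈ xs → m List.∈ ys) →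
    length xs ℕ.≤ length ys
  unique-⊆⇒length-≤ {[]} _ _ = ℕ.z≤n
  unique-⊆⇒length-≤ {x ∷ xs} (x∉ ∷ u) sub with List.∈-∃++ (sub x (here refl))
  ... | (ps , qs , refl) = subst (suc (length xs) ℕ.≤_) (sym (trans (List.length-++ ps)
      (trans (ℕ.+-suc (length ps) (length qs)) (cong suc (sym (List.length-++ ps))))))
    (ℕ.s≤s (unique-⊆⇒length-≤ {xs} {ps ++ qs} u sub′))
    where
    sub′ : ∀ m → m List.∈ xs → m List.∈ ps ++ qs
    sub′ m m∈ with List.∈-++⁻ ps (sub m (there m∈))
    ... | inj₁ m∈ps = List.∈-++⁺ˡ m∈ps
    ... | inj₂ (here refl) = ⊥-elim (All.lookup x∉ m∈ refl)
    ... | inj₂ (there m∈qs) = List.∈-++⁺ʳ ps m∈qs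

  card-≤-length : ∀ xs → card xs ℕ.≤ length xs
  card-≤-length xs = unique-⊆⇒length-≤ (Dedup.deduplicate-! xs) λ m → List.∈-deduplicate⁻ ℕ._≟_ xs

  card-++ : ∀ xs ys → card (xs ++ ys) ℕ.≤ card xs ℕ.+ card ys
  card-++ xs ys = ℕ.≤-trans
    (unique-⊆⇒length-≤ (Dedup.deduplicate-! (xs ++ ys)) λ m m∈ →
      split m (List.∈-++⁻ xs (List.∈-deduplicate⁻ ℕ._≟_ (xs ++ ys) m∈)))
    (ℕ.≤-reflexive (List.length-++ (deduplicate ℕ._≟_ xs)))
    where
    split : ∀ m → m List.∈ xs ⊎ m List.∈ ys →
      m List.∈ deduplicate ℕ._≟_ xs ++ deduplicate ℕ._≟_ ys
    split m (inj₁ p) = List.∈-++⁺ˡ (List.∈-deduplicate⁺ ℕ._≟_ p)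
    split m (inj₂ q) = List.∈-++⁺ʳ (deduplicate ℕ._≟_ xs) (List.∈-deduplicate⁺ ℕ._≟_ q)

  total : ∀ {a} {X : Set a} → (X → ℕ) → List X → ℕ
  total k = foldr (λ x n → k x ℕ.+ n) 0

  card-concatMap : ∀ {a} {X : Set a} (h : X → FinSet) (k : X → ℕ) xs →
    (∀ x → card (h x) ℕ.≤ k x) → card (concatMap h xs) ℕ.≤ total k xs
  card-concatMap h k [] le = ℕ.z≤n
  card-concatMap h k (x ∷ xs) le = ℕ.≤-trans (card-++ (h x) (concatMap h xs))
    (ℕ.+-mono-≤ (le x) (card-concatMap h k xs le))

  ∈-concatMap-intro : ∀ {a b} {X : Set a} {Y : Set b} {h : X → List Y} {x xs y} →
    x List.∈ xs → y List.∈ h x → y List.∈ concatMap h xs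
  ∈-concatMap-intro {h = h} x∈ y∈ = List.∈-concatMap⁺ h (List.lose x∈ y∈)

  ∈-concatMap-elim : ∀ {a b} {X : Set a} {Y : Set b} (h : X → List Y) xs {y} →
    y List.∈ concatMap h xs → Σ[ x ∈ X ] x List.∈ xs × y List.∈ h x
  ∈-concatMap-elim h xs y∈ = List.find (List.∈-concatMap⁻ h y∈)

  -- The unfolded game

  -- Besides Gₙ, Player II plays the next term of a witness for the membership in 𝒥
  -- of f⁻¹[⋃ Fₙ].
  module UnfoldedGame (𝒥 : Family ℕ) (A : 𝒫 ℕ) (f : A ⟶ω)
    (a : Analytic 𝒥) (mono : Monotone (relation a)) where

    -- A position before a move of Player II: the allowance of Player I, the terms
    -- of the witness, the last one first, and the numbers played by Player I.
    record Position : Set where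
      constructor position
      field
        allowed : ℕ
        terms   : List ℕ
        played  : FinSet
    open Position public

    start : ℕ → Position
    start k = position k [] []

    extend : Position → ℕ → FinSet → ℕ → Position
    extend p c F k = position k (c ∷ terms p) (F ++ played p)

    -- The terms cs, the last one first, are an initial segment of w.
    Extends : (ℕ → ℕ) → List ℕ → Set
    Extends w cs = cs ≡ applyDownFrom w (length cs)

    -- Player II cannot continue to a witness for the numbers played so far.
    Lost : Position → Set₁
    Lost p = ∀ w → Extends w (terms p) → ¬ relation a (preimage f (List._∈ played p)) w

    -- The positions won by Player I, together with a winning strategy: the game is
    -- open for Player I, hence the strategies are well-founded trees.
    data Won (p : Position) : Set₁ where
      now  : Lost p → Won p
      play : (F : FinSet → ℕ → FinSet) (k : FinSet → ℕ → ℕ) →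
             (∀ G c m → m List.∈ F G c → ¬ m List.∈ G) →
             (∀ G c → card (F G c) ℕ.≤ allowed p) →
             (∀ G c → Won (extend p c (F G c) (k G c))) → Won p

    -- Player I wins the original game by simulating plays of the unfolded game. At
    -- stage n every simulated play is continued with every term c ≤ n of the witness,
    -- and is also kept as it is; so the plays with a given witness are simulated with
    -- delays, while at each stage only finitely many plays have to be served.
    module Simulation (k₀ : ℕ) (won : Won (start k₀)) where

      Sim : Set₁
      Sim = Σ[ p ∈ Position ] Won p

      response : FinSet → Sim → ℕ → FinSet
      response G (p , now _)          c = []
      response G (p , play F _ _ _ _) c = F G c

      successor : FinSet → Sim → ℕ → List Sim
      successor G (p , now _)            c = []
      successor G (p , play F k _ _ won) c = [ extend p c (F G c) (k G c) , won G c ]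

      response-card : ∀ G s c → card (response G s c) ℕ.≤ allowed (proj₁ s)
      response-card G (p , now _)           c = ℕ.z≤n
      response-card G (p , play _ _ _ le _) c = le G c

      response-disjoint : ∀ G s c m → m List.∈ response G s c → ¬ m List.∈ G
      response-disjoint G (p , play _ _ d _ _) c m = d G c m

      -- The number of the stage and the simulated plays.
      State : Set₁
      State = ℕ × List Sim

      -- The admissible terms at stage n.
      terms≤ : ℕ → List ℕ
      terms≤ n = upTo (suc n)

      out : State → FinSet → FinSet
      out (n , sims) G = concatMap (λ s → concatMap (response G s) (terms≤ n)) sims

      step : State → FinSet → State
      step (n , sims) G =
        suc n , sims ++ concatMap (λ s → concatMap (successor G s) (terms≤ n)) sims

      allow : State → ℕ
      allow (n , sims) = total (λ s → total (λ _ → allowed (proj₁ s)) (terms≤ n)) sims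

      initial : State
      initial = 0 , [ start k₀ , won ]

      -- The value at [] is arbitrary.
      run : State → List FinSet → FinSet × ℕ
      run s []            = [] , 0
      run s (G ∷ [])      = out s G , allow (step s G)
      run s (G ∷ G′ ∷ Gs) = run (step s G) (G′ ∷ Gs)

      σ : StrategyI
      σ = record { k₀ = allow initial ; respond = run initial }

      -- The states of a play in which Player II plays G.
      states : State → (ℕ → FinSet) → ℕ → State
      states s G zero    = s
      states s G (suc n) = states (step s (G 0)) (G ∘ suc) n

      states-suc : ∀ s G n → states s G (suc n) ≡ step (states s G n) (G n)
      states-suc s G zero    = refl
      states-suc s G (suc n) = states-suc (step s (G 0)) (G ∘ suc) n

      run-states : ∀ s G n → run s (applyUpTo G (suc n)) ≡
        (out (states s G n) (G n) , allow (step (states s G n) (G n)))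
      run-states s G zero    = refl
      run-states s G (suc n) = run-states (step s (G 0)) (G ∘ suc) n

      module _ (G : ℕ → FinSet) where

        open Play σ G

        state : ℕ → State
        state = states initial G

        stage-≡ : ∀ n → proj₁ (state n) ≡ n
        stage-≡ zero    = refl
        stage-≡ (suc n) = trans (cong proj₁ (states-suc initial G n)) (cong suc (stage-≡ n))

        F-≡ : ∀ n → F n ≡ out (state n) (G n)
        F-≡ n = cong proj₁ (run-states initial G n)

        k-≡ : ∀ n → k n ≡ allow (state n)
        k-≡ zero    = refl
        k-≡ (suc n) =
          trans (cong proj₂ (run-states initial G n)) (cong allow (sym (states-suc initial G n)))

        out-disjoint : ∀ st G m → m List.∈ out st G → ¬ m List.∈ G
        out-disjoint (n , sims) G m m∈ =
          let (s , _ , m∈′) = ∈-concatMap-elim _ sims m∈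
              (c , _ , m∈″) = ∈-concatMap-elim (response G s) (terms≤ n) m∈′
          in response-disjoint G s c m m∈″

        out-card : ∀ st G → card (out st G) ℕ.≤ allow st
        out-card (n , sims) G = card-concatMap _ _ sims λ s →
          card-concatMap (response G s) _ (terms≤ n) (response-card G s)

        legal : Legal
        legal n =
          (λ m m∈F → out-disjoint (state n) (G n) m (subst (m List.∈_) (F-≡ n) m∈F)) ,
          ℕ.≤-trans (ℕ.≤-reflexive (cong card (F-≡ n)))
            (ℕ.≤-trans (out-card (state n) (G n)) (ℕ.≤-reflexive (sym (k-≡ n))))

        Active : Sim → ℕ → Set₁
        Active s n = s List.∈ proj₂ (state n)

        active-later : ∀ {s n} d → Active s n → Active s (d ℕ.+ n)
        active-later zero act = act
        active-later {s} {n} (suc d) act = subst (λ st → s List.∈ proj₂ st)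
          (sym (states-suc initial G (d ℕ.+ n))) (List.∈-++⁺ˡ (active-later d act))

        -- No play with a witness for the outcome can be simulated.
        no-witness : ∀ w → relation a (preimage f ⋃F) w → ∀ p (won : Won p) n → Active (p , won) n →
          Extends w (terms p) → (∀ m → m List.∈ played p → ⋃F m) → ⊥
        no-witness w r p (now lost) n act ext sub =
          lost w ext (mono _ _ w (λ (n∈A , m∈) → n∈A , sub _ m∈) r)
        no-witness w r p (play F′ k′ d le next) n act ext sub =
          no-witness w r _ (next (G N) c) (suc N)
            (subst (λ st → (extend p c (F′ (G N) c) (k′ (G N) c) , next (G N) c) List.∈ proj₂ st)
              (sym (states-suc initial G N))
              (List.∈-++⁺ʳ (proj₂ (state N)) (∈-concatMap-intro act′
                (∈-concatMap-intro {h = successor (G N) sim} c∈ (here refl)))))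
            (cong (c ∷_) ext)
            (λ m m∈ → Sum.[ (λ m∈F → N , subst (m List.∈_) (sym (F-≡ N))
                              (∈-concatMap-intro act′
                                (∈-concatMap-intro {h = response (G N) sim} c∈ m∈F)))
                          , sub m ] (List.∈-++⁻ (F′ (G N) c) m∈))
          where
          c N : ℕ
          c = w (length (terms p))
          -- a late stage, at which the term c is allowed
          N = c ℕ.+ n

          sim : Sim
          sim = p , play F′ k′ d le next

          act′ : Active sim N
          act′ = active-later c act

          c∈ : c List.∈ terms≤ (proj₁ (state N))
          c∈ = List.∈-upTo⁺ (ℕ.s≤s (ℕ.≤-trans (ℕ.m≤m+n c n) (ℕ.≤-reflexive (sym (stage-≡ N)))))

      winning : IsIdeal 𝒥 → IsWinningI 𝒥 A f σ
      winning ideal G = legal G , λ small →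
        let (w , r) = witness a _ (∈↾⇒∈ ideal small)
        in no-witness G w r (start k₀) won 0 (here refl) refl λ m ()

  -- Weights that are constant on intervals

  -- The members of a finite list that belong to P.
  select : (ℕ → Set) → List ℕ → List ℕ
  select P = filter (λ m → em {P = P m})

  ∈-select⁺ : ∀ P {m xs} → m List.∈ xs → P m → m List.∈ select P xs
  ∈-select⁺ P = List.∈-filter⁺ (λ m → em {P = P m})

  ∈-select⁻ : ∀ P {m} xs → m List.∈ select P xs → m List.∈ xs × P m
  ∈-select⁻ P xs = List.∈-filter⁻ (λ m → em {P = P m}) {xs = xs}

  select-unique : ∀ P {xs} → Unique xs → Unique (select P xs)
  select-unique P = Unique.filter⁺ (λ m → em {P = P m})

  ·-monoˡ-≤ : ∀ q → 0ℚ ℚ.≤ q → ∀ {m n} → m ℕ.≤ n → m · q ℚ.≤ n · q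
  ·-monoˡ-≤ q 0≤q {zero} {zero}  _ = ℚ.≤-refl
  ·-monoˡ-≤ q 0≤q {zero} {suc n} _ = ℚ.+-mono-≤ 0≤q (·-monoˡ-≤ q 0≤q {zero} {n} ℕ.z≤n)
  ·-monoˡ-≤ q 0≤q (ℕ.s≤s le)       = ℚ.+-monoʳ-≤ q (·-monoˡ-≤ q 0≤q le)

  -- The interval [b t , b (t+1)) has at least 2ᵗ elements, of weight 2⁻ᵗ each.
  module Intervals (b : ℕ → ℕ) (b-0 : b 0 ≡ 0) (b-suc : ∀ t → b t ℕ.+ 2 ℕ.^ t ℕ.≤ b (suc t)) where

    b-≤-suc : ∀ t → b t ℕ.≤ b (suc t)
    b-≤-suc t = ℕ.≤-trans (ℕ.m≤m+n (b t) (2 ℕ.^ t)) (b-suc t)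

    b-mono : ∀ {s t} → s ℕ.≤ t → b s ℕ.≤ b t
    b-mono {s} s≤t = go (ℕ.≤⇒≤′ s≤t)
      where
      go : ∀ {t} → s ℕ.≤′ t → b s ℕ.≤ b t
      go ℕ.≤′-refl = ℕ.≤-refl
      go (ℕ.≤′-step {n = t} le) = ℕ.≤-trans (go le) (b-≤-suc t)

    ≤-b : ∀ t → t ℕ.≤ b t
    ≤-b zero    = ℕ.z≤n
    ≤-b (suc t) = ℕ.≤-trans (ℕ.≤-reflexive (ℕ.+-comm 1 t))
      (ℕ.≤-trans (ℕ.+-mono-≤ (≤-b t) (ℕ.m^n>0 2 t)) (b-suc t))

    -- The index of the interval containing m.
    index : ℕ → ℕ
    index m = greatest (λ t → b t ℕ.≤ m) m

    index-lower : ∀ m → b (index m) ℕ.≤ m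
    index-lower m = go (index m) (greatest-holds (λ t → b t ℕ.≤ m) m)
      where
      go : ∀ t → (1 ℕ.≤ t → b t ℕ.≤ m) → b t ℕ.≤ m
      go zero    _ = subst (ℕ._≤ m) (sym b-0) ℕ.z≤n
      go (suc t) h = h (ℕ.s≤s ℕ.z≤n)

    index-upper : ∀ m → m ℕ.< b (suc (index m))
    index-upper m = ℕ.≰⇒> λ le → ℕ.<-irrefl refl
      (≤-greatest (λ t → b t ℕ.≤ m) m (suc (index m)) (ℕ.≤-trans (≤-b (suc (index m))) le) le)

    index-unique : ∀ {m t} → b t ℕ.≤ m → m ℕ.< b (suc t) → index m ≡ t
    index-unique {m} {t} lower upper = ℕ.≤-antisym
      (ℕ.≮⇒≥ λ lt → ℕ.<⇒≱ upper (ℕ.≤-trans (b-mono lt) (index-lower m)))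
      (ℕ.≮⇒≥ λ lt → ℕ.<⇒≱ (index-upper m) (ℕ.≤-trans (b-mono lt) lower))

    interval-list : ℕ → List ℕ
    interval-list t = applyUpTo (b t ℕ.+_) (b (suc t) ℕ.∸ b t)

    ∈-interval⁺ : ∀ {m t} → b t ℕ.≤ m → m ℕ.< b (suc t) → m List.∈ interval-list t
    ∈-interval⁺ {m} {t} lower upper = subst (List._∈ interval-list t) (ℕ.m+[n∸m]≡n lower)
      (List.∈-applyUpTo⁺ (b t ℕ.+_) (ℕ.∸-monoˡ-< upper lower))

    ∈-interval⁻ : ∀ {m} t → m List.∈ interval-list t → b t ℕ.≤ m × m ℕ.< b (suc t)
    ∈-interval⁻ t m∈ with List.∈-applyUpTo⁻ (b t ℕ.+_) m∈
    ... | (i , lt , refl) = ℕ.m≤m+n (b t) i ,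
      ℕ.≤-trans (ℕ.+-monoʳ-< (b t) lt) (ℕ.≤-reflexive (ℕ.m+[n∸m]≡n (b-≤-suc t)))

    interval-unique : ∀ t → Unique (interval-list t)
    interval-unique t = Unique.applyUpTo⁺₁ (b t ℕ.+_) _ λ i<j _ eq →
      ℕ.<⇒≢ i<j (ℕ.+-cancelˡ-≡ (b t) _ _ eq)

    interval-length : ∀ t → 2 ℕ.^ t ℕ.≤ length (interval-list t)
    interval-length t = subst (2 ℕ.^ t ℕ.≤_) (sym (List.length-applyUpTo (b t ℕ.+_) _))
      (ℕ.≤-trans (ℕ.≤-reflexive (sym (ℕ.m+n∸m≡n (b t) (2 ℕ.^ t)))) (ℕ.∸-monoˡ-≤ (b t) (b-suc t)))

    w : ℕ → ℚ
    w m = pow½ (index m)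

    weight : ℕ → ℝ
    weight m = const (w m)

    tall-weight : Tall (Summable weight)
    tall-weight = level⇒tall weight index (λ m _ → ≤-reflℝ (weight m))
      λ j → upTo (b j) , λ {m} lt → List.∈-upTo⁺ (ℕ.≤-trans (index-upper m) (b-mono lt))

    -- The part of B in the interval with index t has at least 2ᵗ elements.
    Heavy : 𝒫 ℕ → ℕ → Set
    Heavy B t = 2 ℕ.^ t ℕ.≤ length (select B (interval-list t))

    -- A set that is heavy on infinitely many intervals is not summable: the parts
    -- of these intervals have weight at least 1.
    heavy-sum : ∀ B → (∀ s → Σ[ t ∈ ℕ ] s ℕ.≤ t × Heavy B t) → ∀ n →
      Σ[ xs ∈ List ℕ ] Unique xs × All B xs × n · 1ℚ ℚ.≤ wsum w xs
    heavy-sum B heavy zero = [] , [] , [] , ℚ.≤-refl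
    heavy-sum B heavy (suc n) =
      let (xs , u , a , le)   = heavy-sum B heavy n
          (t , s≤t , heavy-t) = heavy (bound xs)
          ys                  = select B (interval-list t)
          in-ys               = λ m (m∈ : m List.∈ ys) → ∈-select⁻ B (interval-list t) m∈
          light               = λ m (m∈ : m List.∈ ys) →
            let (lower , upper) = ∈-interval⁻ t (proj₁ (in-ys m m∈))
            in ℚ.≤-reflexive (cong pow½ (sym (index-unique lower upper)))
      in ys ++ xs ,
         Unique.++⁺ (select-unique B (interval-unique t)) u (λ {m} (m∈ys , m∈xs) →
           ℕ.<⇒≱ (<-bound m∈xs) (ℕ.≤-trans s≤t (ℕ.≤-trans (≤-b t)
             (proj₁ (∈-interval⁻ t (proj₁ (in-ys m m∈ys))))))) ,
         All.++⁺ (All.tabulate λ {m} m∈ → proj₂ (in-ys m m∈)) a ,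
         subst (suc n · 1ℚ ℚ.≤_) (sym (wsum-++ w ys xs)) (ℚ.+-mono-≤
           (ℚ.≤-trans (ℚ.≤-reflexive (sym (2^n·pow½ t)))
             (ℚ.≤-trans (·-monoˡ-≤ (pow½ t) (ℚ.<⇒≤ (pow½-positive t)) heavy-t)
               (wsum-≥ w (pow½ t) ys (All.tabulate λ {m} m∈ → light m m∈))))
           le)

    summable⇒light : ∀ B → B ∈ Summable weight → Σ[ s ∈ ℕ ] ∀ t → s ℕ.≤ t → ¬ Heavy B t
    summable⇒light B summable = dne λ none → unbounded⇒∉Summable weight B
      (λ n → let (xs , u , a , le) = heavy-sum B (heavy none) n in
        xs , u , a , ≤-transℝ (const (n · 1ℚ)) (const (wsum w xs)) (sum weight xs)
          (const-mono-≤ le) (wsum-≤-sum weight w xs (All.universal (λ m → ≤-reflℝ (weight m)) xs)))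
      summable
      where
      heavy : ¬ (Σ[ s ∈ ℕ ] ∀ t → s ℕ.≤ t → ¬ Heavy B t) → ∀ s → Σ[ t ∈ ℕ ] s ℕ.≤ t × Heavy B t
      heavy none s = ¬∀¬⇒∃ λ k → none (s , λ t s≤t h → k t (s≤t , h))

    is-weight : IsWeight weight
    is-weight = record
      { nonNegative = λ n → const-mono-≤ (ℚ.<⇒≤ (pow½-positive (index n)))
      ; divergent   = λ summable → let (s , light) = summable⇒light U summable in
          light s ℕ.≤-refl (subst (λ xs → 2 ℕ.^ s ℕ.≤ length xs)
            (sym (List.filter-all (λ m → em {P = U m})
              (All.universal (λ _ → tt) (interval-list s))))
            (interval-length s))
      }

  -- Determinacy of the unfolded game

  -- The subsets of a finite list, as sublists.
  sublists : List ℕ → List FinSet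
  sublists []       = [ [] ]
  sublists (x ∷ xs) = sublists xs ++ map (x ∷_) (sublists xs)

  []∈sublists : ∀ xs → [] List.∈ sublists xs
  []∈sublists []       = here refl
  []∈sublists (x ∷ xs) = List.∈-++⁺ˡ ([]∈sublists xs)

  select∈sublists : ∀ P xs → select P xs List.∈ sublists xs
  select∈sublists P [] = here refl
  select∈sublists P (x ∷ xs) with em {P = P x}
  ... | yes _ = List.∈-++⁺ʳ (sublists xs) (List.∈-map⁺ (x ∷_) (select∈sublists P xs))
  ... | no _  = List.∈-++⁺ˡ (select∈sublists P xs)

  applyDownFrom-agree : ∀ w w′ n → applyDownFrom w n ≡ applyDownFrom w′ n → AgreeSeq n w w′
  applyDownFrom-agree w w′ (suc n) eq m (ℕ.s≤s m≤n) with ℕ.m≤n⇒m<n∨m≡n m≤n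
  ... | inj₁ m<n  = applyDownFrom-agree w w′ n (List.∷-injectiveʳ eq) m m<n
  ... | inj₂ refl = List.∷-injectiveˡ eq

  -- A closed relation that holds for all members of an increasing sequence of sets,
  -- with witnesses approximating w, holds for the union with the witness w.
  closed-limit : ∀ {𝒥} (a : Analytic 𝒥) (S : ℕ → 𝒫 ℕ) (w : ℕ → ℕ) → (∀ n → S n ⊆ S (suc n)) →
    (∀ n → Σ[ w′ ∈ (ℕ → ℕ) ] AgreeSeq n w w′ × relation a (S n) w′) →
    relation a (λ m → Σ[ n ∈ ℕ ] S n m) w
  closed-limit a S w increasing approx = dne λ ¬r →
    let (N , h)       = closed a S∞ w ¬r
        (n , N≤n , c) = late N
        (w′ , b , r)  = approx n
    in h (S n) w′ (λ m m<N → mk⇔ (c m m<N) (λ m∈ → n , m∈)) (agreeSeq-≤ {y = w} {w′} N≤n b) r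
    where
    S∞ : 𝒫 ℕ
    S∞ m = Σ[ n ∈ ℕ ] S n m

    S-mono : ∀ {k n m} → k ℕ.≤ n → S k m → S n m
    S-mono {k} {n} {m} k≤n = go (ℕ.≤⇒≤′ k≤n)
      where
      go : ∀ {n} → k ℕ.≤′ n → S k m → S n m
      go ℕ.≤′-refl p = p
      go (ℕ.≤′-step le) p = increasing _ (go le p)

    -- a stage at which S∞ is exhausted below M
    late : ∀ M → Σ[ n ∈ ℕ ] M ℕ.≤ n × (∀ m → m ℕ.< M → S∞ m → S n m)
    late zero = 0 , ℕ.z≤n , λ m ()
    late (suc M) with late M
    ... | (n , M≤n , c) = add em
      where
      add : Dec (S∞ M) → Σ[ n ∈ ℕ ] suc M ℕ.≤ n × (∀ m → m ℕ.< suc M → S∞ m → S n m)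
      add (yes (k , p)) = suc (n ℕ.⊔ k) , ℕ.s≤s (ℕ.≤-trans M≤n (ℕ.m≤m⊔n n k)) , λ m m≤M s →
        increasing _ (Sum.[ (λ m<M → S-mono (ℕ.m≤m⊔n n k) (c m m<M s))
                          , (λ { refl → S-mono (ℕ.m≤n⊔m n k) p }) ]
          (ℕ.m≤n⇒m<n∨m≡n (ℕ.s≤s⁻¹ m≤M)))
      add (no ∉) = suc n , ℕ.s≤s M≤n , λ m m≤M s →
        increasing _ (Sum.[ (λ m<M → c m m<M s) , (λ { refl → ⊥-elim (∉ s) }) ]
          (ℕ.m≤n⇒m<n∨m≡n (ℕ.s≤s⁻¹ m≤M)))

  -- If Player I does not win, then Player II has a strategy, and f shows that 𝒥 ↾ A
  -- is above the summable ideal of a weight adapted to this strategy.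
  module Undetermined (𝒥 : Family ℕ) (ideal : IsIdeal 𝒥) (A : 𝒫 ℕ) (f : A ⟶ω)
    (to-one : (𝒥 -to-one) f) (a : Analytic 𝒥) (mono : Monotone (relation a)) where

    open UnfoldedGame 𝒥 A f a mono

    preimage-finite : ∀ xs → preimage f (List._∈ xs) ∈ 𝒥
    preimage-finite [] = ∅-ideal ideal λ m ()
    preimage-finite (x ∷ xs) = IsIdeal.⊆-closed ideal
      (λ { (p , here eq)  → inj₁ (p , sym eq)
         ; (p , there m∈) → inj₂ (p , m∈) })
      (IsIdeal.∪-closed ideal (to-one x) (preimage-finite xs))

    module _ (not-won : ∀ k → ¬ Won (start k)) where

      -- A move of Player II after which Player I still does not win.
      Good-move : Position → FinSet × ℕ → Set₁
      Good-move p (G , c) = ∀ F k → (∀ m → m List.∈ F → ¬ m List.∈ G) → card F ℕ.≤ allowed p →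
        ¬ Won (extend p c F k)

      good-move : ∀ p → ¬ Won p → Σ[ move ∈ FinSet × ℕ ] Good-move p move
      good-move p ¬won = ¬∀¬⇒∃ λ bad →
        let reply = λ G c → refute p G c (bad (G , c)) in
        ¬won (play (λ G c → proj₁ (reply G c)) (λ G c → proj₁ (proj₂ (reply G c)))
          (λ G c → proj₁ (proj₂ (proj₂ (reply G c))))
          (λ G c → proj₁ (proj₂ (proj₂ (proj₂ (reply G c)))))
          (λ G c → proj₂ (proj₂ (proj₂ (proj₂ (reply G c))))))
        where
        refute : ∀ p G c → ¬ Good-move p (G , c) → Σ[ F ∈ FinSet ] Σ[ k ∈ ℕ ]
          (∀ m → m List.∈ F → ¬ m List.∈ G) × card F ℕ.≤ allowed p × Won (extend p c F k)
        refute p G c bad = dne λ none → bad λ F k d le won → none (F , k , d , le , won)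

      -- The strategy of Player II; its values matter only where Player I does not win.
      τ : Position → FinSet × ℕ
      τ p = by-case em
        where
        by-case : Dec (Σ[ move ∈ FinSet × ℕ ] Good-move p move) → FinSet × ℕ
        by-case (yes (move , _)) = move
        by-case (no _)           = [] , 0

      τ-good : ∀ p → ¬ Won p → Good-move p (τ p)
      τ-good p ¬won with em {P = Σ[ move ∈ FinSet × ℕ ] Good-move p move}
      ... | yes (_ , good) = good
      ... | no none        = ⊥-elim (none (good-move p ¬won))

      reply : Position → FinSet → ℕ → Position
      reply p F k = extend p (proj₂ (τ p)) F k

      -- Stage t consists of the left endpoint of the interval with index t and of the
      -- positions reached by playing subsets of some of the earlier intervals. The
      -- next endpoint exceeds the answers of Player II to these positions, which are
      -- therefore disjoint from the intervals with index greater than t. The initial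
      -- allowance 4 suffices for plays that begin with the interval of index 1 or 2.
      Stage : Set
      Stage = ℕ × List Position

      end : ℕ → Stage → ℕ
      end t (n , ps) = (n ℕ.+ 2 ℕ.^ t) ℕ.⊔ bound (concatMap (λ p → proj₁ (τ p)) ps)

      replies : ℕ → List FinSet → Position → List Position
      replies t Fs p = map (λ F → reply p F (2 ℕ.^ (2 ℕ.+ t))) Fs

      stage : ℕ → Stage
      stage zero    = 0 , [ start 4 ]
      stage (suc t) = e , proj₂ (stage t) ++ concatMap (replies t (sublists next)) (proj₂ (stage t))
        where
        e n : ℕ
        e = end t (stage t)
        n = proj₁ (stage t)

        -- the interval from n to e
        next : List ℕ
        next = applyUpTo (n ℕ.+_) (e ℕ.∸ n)

      b : ℕ → ℕ
      b t = proj₁ (stage t)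

      positions : ℕ → List Position
      positions t = proj₂ (stage t)

      open Intervals b refl (λ t → ℕ.m≤m⊔n (b t ℕ.+ 2 ℕ.^ t) _)

      answer-below : ∀ t {p m} → p List.∈ positions t → m List.∈ proj₁ (τ p) → m ℕ.< b (suc t)
      answer-below t p∈ m∈ =
        ℕ.≤-trans (<-bound (∈-concatMap-intro p∈ m∈)) (ℕ.m≤n⊔m (b t ℕ.+ 2 ℕ.^ t) _)

      reply∈ : ∀ t {p F} → p List.∈ positions t → F List.∈ sublists (interval-list t) →
        reply p F (2 ℕ.^ (2 ℕ.+ t)) List.∈ positions (suc t)
      reply∈ t {p} p∈ F∈ = List.∈-++⁺ʳ (positions t)
        (∈-concatMap-intro p∈ (List.∈-map⁺ (λ F → reply p F (2 ℕ.^ (2 ℕ.+ t))) F∈))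

      -- The play in which Player I plays the parts of a set in every other interval,
      -- from the interval with index s + 1 on. By the parity of the indices two such
      -- plays exhaust the set up to the interval with index 0.
      module Run (F : ℕ → FinSet) (F∈ : ∀ t → F t List.∈ sublists (interval-list t))
                 (F⊆ : ∀ t m → m List.∈ F t → m List.∈ interval-list t)
                 (small : ∀ t → card (F t) ℕ.≤ 2 ℕ.^ t)
                 (s : ℕ) (s≤1 : s ℕ.≤ 1) where

        time : ℕ → ℕ
        time zero    = s
        time (suc j) = 2 ℕ.+ time j

        pos : ℕ → Position
        pos zero    = start 4
        pos (suc j) = reply (pos j) (F (suc (time j))) (2 ℕ.^ (3 ℕ.+ time j))

        start∈ : ∀ t → start 4 List.∈ positions t
        start∈ zero    = here refl
        start∈ (suc t) = List.∈-++⁺ˡ (start∈ t)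

        pos∈ : ∀ j → pos j List.∈ positions (time j)
        pos∈ zero    = start∈ s
        pos∈ (suc j) = reply∈ (suc (time j)) (List.∈-++⁺ˡ (pos∈ j)) (F∈ (suc (time j)))

        allowed-pos : ∀ j → 2 ℕ.^ suc (time j) ℕ.≤ allowed (pos j)
        allowed-pos zero    = ℕ.^-monoʳ-≤ 2 (ℕ.s≤s s≤1)
        allowed-pos (suc j) = ℕ.≤-refl

        not-won-pos : ∀ j → ¬ Won (pos j)
        not-won-pos zero    = not-won 4
        not-won-pos (suc j) = τ-good (pos j) (not-won-pos j) (F (suc (time j))) _
          (λ m m∈F m∈G → ℕ.<⇒≱ (answer-below (time j) (pos∈ j) m∈G)
            (proj₁ (∈-interval⁻ (suc (time j)) (F⊆ (suc (time j)) m m∈F))))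
          (ℕ.≤-trans (small (suc (time j))) (allowed-pos j))

        w′ : ℕ → ℕ
        w′ j = proj₂ (τ (pos j))

        terms-pos : ∀ j → terms (pos j) ≡ applyDownFrom w′ j
        terms-pos zero    = refl
        terms-pos (suc j) = cong (w′ j ∷_) (terms-pos j)

        approximation : ∀ j → Σ[ v ∈ (ℕ → ℕ) ] AgreeSeq j w′ v ×
          relation a (preimage f (List._∈ played (pos j))) v
        approximation j =
          let (v , h)   = ¬∀⇒∃¬ {P = λ v → Extends v (terms (pos j)) →
                            ¬ relation a (preimage f (List._∈ played (pos j))) v}
                            (λ lost → not-won-pos j (now lost))
              (ext , r) = ¬→⇒×¬ h
          in v , applyDownFrom-agree w′ v j (trans (sym (terms-pos j)) (trans ext
                   (cong (applyDownFrom v) (trans (cong length (terms-pos j))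
                     (List.length-applyDownFrom w′ j))))) ,
             dne r

        outcome∈ : preimage f (λ m → Σ[ j ∈ ℕ ] m List.∈ F (suc (time j))) ∈ 𝒥
        outcome∈ = IsIdeal.⊆-closed ideal
          (λ (p , j , m∈) → suc j , p , List.∈-++⁺ˡ m∈)
          (sound a _ w′ (closed-limit a (λ j → preimage f (List._∈ played (pos j))) w′
            (λ j (p , m∈) → p , List.∈-++⁺ʳ (F (suc (time j))) m∈) approximation))

      -- From the index s on, the parts of B are admissible moves of Player I.
      light⇒∈ : ∀ B s → (∀ t → s ℕ.≤ t → ¬ Heavy B t) → preimage f B ∈ 𝒥
      light⇒∈ B s light = IsIdeal.⊆-closed ideal
        (λ {m} (p , fm∈B) →
          locate p fm∈B (index-lower (f m p)) (index-upper (f m p)) (parity (index (f m p))))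
        (IsIdeal.∪-closed ideal (preimage-finite (upTo (b (suc s))))
          (IsIdeal.∪-closed ideal (Even.outcome∈) (Odd.outcome∈)))
        where
        -- The part of B in the interval with index t, omitted for t < s.
        part : ∀ t → Dec (s ℕ.≤ t) → FinSet
        part t (yes _) = select B (interval-list t)
        part t (no _)  = []

        F : ℕ → FinSet
        F t = part t (s ℕ.≤? t)

        F∈ : ∀ t → F t List.∈ sublists (interval-list t)
        F∈ t with s ℕ.≤? t
        ... | yes _ = select∈sublists B (interval-list t)
        ... | no _  = []∈sublists (interval-list t)

        F⊆ : ∀ t m → m List.∈ F t → m List.∈ interval-list t
        F⊆ t m m∈ with s ℕ.≤? t
        ... | yes _ = proj₁ (∈-select⁻ B (interval-list t) m∈)
        F⊆ t m () | no _

        small : ∀ t → card (F t) ℕ.≤ 2 ℕ.^ t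
        small t with s ℕ.≤? t
        ... | yes s≤t = ℕ.≤-trans (card-≤-length (select B (interval-list t)))
          (ℕ.<⇒≤ (ℕ.≰⇒> (light t s≤t)))
        ... | no _    = ℕ.z≤n

        ∈F : ∀ t m → s ℕ.≤ t → m List.∈ interval-list t → B m → m List.∈ F t
        ∈F t m s≤t m∈ m∈B with s ℕ.≤? t
        ... | yes _  = ∈-select⁺ B m∈ m∈B
        ... | no s≰t = ⊥-elim (s≰t s≤t)

        module Even = Run F F∈ F⊆ small 1 ℕ.≤-refl
        module Odd  = Run F F∈ F⊆ small 0 ℕ.z≤n

        Parity : ℕ → Set
        Parity t = t ≡ 0 ⊎ (Σ[ j ∈ ℕ ] t ≡ suc (Even.time j)) ⊎ (Σ[ j ∈ ℕ ] t ≡ suc (Odd.time j))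

        parity : ∀ t → Parity t
        parity zero = inj₁ refl
        parity (suc zero) = inj₂ (inj₂ (0 , refl))
        parity (suc (suc t)) with parity t
        ... | inj₁ refl              = inj₂ (inj₁ (0 , refl))
        ... | inj₂ (inj₁ (j , refl)) = inj₂ (inj₁ (suc j , refl))
        ... | inj₂ (inj₂ (j , refl)) = inj₂ (inj₂ (suc j , refl))

        -- The outcomes of the two runs, and finitely many fibers.
        Target : 𝒫 ℕ
        Target = preimage f (List._∈ upTo (b (suc s))) ∪
          (preimage f (λ m → Σ[ j ∈ ℕ ] m List.∈ F (suc (Even.time j))) ∪
           preimage f (λ m → Σ[ j ∈ ℕ ] m List.∈ F (suc (Odd.time j))))

        locate : ∀ {m t} (p : m ∈ A) → B (f m p) → b t ℕ.≤ f m p → f m p ℕ.< b (suc t) →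
          Parity t → Target m
        locate {m} {t} p fm∈B lower upper = go (s ℕ.≤? t)
          where
          below : t ℕ.≤ s → Target m
          below t≤s = inj₁ (p , List.∈-upTo⁺ (ℕ.≤-trans upper (b-mono {suc t} {suc s} (ℕ.s≤s t≤s))))

          fm∈F : s ℕ.≤ t → f m p List.∈ F t
          fm∈F s≤t = ∈F t (f m p) s≤t (∈-interval⁺ {f m p} {t} lower upper) fm∈B

          go : Dec (s ℕ.≤ t) → Parity t → Target m
          go (no s≰t) _ = below (ℕ.<⇒≤ (ℕ.≰⇒> s≰t))
          go (yes _) (inj₁ t≡0) = below (subst (ℕ._≤ s) (sym t≡0) ℕ.z≤n)
          go (yes s≤t) (inj₂ (inj₁ (j , eq))) =
            inj₂ (inj₁ (p , j , subst (λ t → f m p List.∈ F t) eq (fm∈F s≤t)))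
          go (yes s≤t) (inj₂ (inj₂ (j , eq))) =
            inj₂ (inj₂ (p , j , subst (λ t → f m p List.∈ F t) eq (fm∈F s≤t)))

      K-above : Σ[ g ∈ (ℕ → ℝ) ] IsWeight g × Tall (Summable g) × KAbove 𝒥 A (Summable g)
      K-above = weight , is-weight , tall-weight , f , λ B summable →
        let (s , light) = summable⇒light B summable in ∈⇒∈↾ proj₁ (light⇒∈ B s light)

  -- Player I wins the unfolded game, since otherwise 𝒥 ↾ A would be above a tall
  -- summable ideal.
  borel⇒I-wins : ∀ 𝒥 → IsIdeal 𝒥 → IsBorel 𝒥 → (∀ A → A ∉ 𝒥 → NotKAboveTallSummable 𝒥 A) →
    PlayerIWinsAll 𝒥
  borel⇒I-wins 𝒥 ideal borel not-above A A∉𝒥 f to-one =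
    let (a , mono) = analytic-ideal ideal (proj₁ (borel⇒analytic borel))
        open UnfoldedGame 𝒥 A f a mono
        (k , won)  = ¬∀¬⇒∃ λ not-won →
          let (g , is-weight , tall , above) = Undetermined.K-above 𝒥 ideal A f to-one a mono not-won
          in not-above A A∉𝒥 g is-weight tall above
    in Simulation.σ k won , Simulation.winning k won ideal

theorem5p7 : (∀ {ℓ} → ExcludedMiddle ℓ) →
    (∀ {a b} → Extensionality a b) →
    ∀ (ℐ 𝒥 : Family ℕ) → IsIdeal ℐ → IsIdeal 𝒥 →
    (ContainsTallSummable ℐ → PlayerIWinsAll 𝒥 →
    cov-ℳ ≤ᶜ 𝔣𝔦𝔭 ℐ 𝒥 U)
    ×
    (ContainsTallSummable ℐ → IsBorel 𝒥 →
    (∀ A → A ∉ 𝒥 → NotKAboveTallSummable 𝒥 A) →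
    cov-ℳ ≤ᶜ 𝔣𝔦𝔭 ℐ 𝒥 U)
theorem5p7 em fe ℐ 𝒥 ideal-ℐ ideal-𝒥 =
  cov-≤-fip ℐ 𝒥 ideal-ℐ ideal-𝒥 ,
  λ tall-summable borel not-above →
    cov-≤-fip ℐ 𝒥 ideal-ℐ ideal-𝒥 tall-summable (borel⇒I-wins 𝒥 ideal-𝒥 borel not-above)
  where open Classical em fe
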